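{- Let $N,M$ be finite sets with $z\in M$, $L:=M\setminus z\subset N$ and $N\setminus L=\{x,y\}$, where $x\ne y$. Let $r\in\mathbb{R}^{\mathcal{P}(M)}$ and let $T_{\uparrow\uparrow}(r)\in\mathbb{R}^{\mathcal{P}(N)}$ be its upper replication. (i) One has $m=T_{\uparrow\uparrow}(r)\in\mathcal{K}(N)$ if and only if [$r\in\mathcal{K}(M)$ and $r(L)\ge r(M)$]. The independency model induced by $m$ is then determined as follows: given $\langle a,b|C\rangle\in\mathcal{E}(N)$, the statement $a\perp b\mid C\ [m]$ is equivalent to - $a\cap L\perp b\cap L\mid z\cup(C\cap L)\ [r]$, in case $\{x,y\}\cap C\ne\emptyset$; - $a\perp b\mid C\ [r]$, in case $(a\cup b\cup C)\subseteq L$; - $z\perp\{a,b\}\cap L\mid C\ [r]$, in case $|\{x,y\}\cap\{a,b\}|=1$ and $\{x,y\}\cap C=\emptyset$; - $r(z\cup C)=r(C)$, in case $\{x,y\}=\{a,b\}$. (ii) If $r\in\mathcal{K}_u(M)$ then $T_{\uparrow\uparrow}(r)\in\mathcal{K}_u(N)$. A function $r\in\mathcal{K}_u(M)$ is extreme in $\mathcal{K}(M)$ if and only if $T_{\uparrow\uparrow}(r)$ is extreme in $\mathcal{K}(N)$. (iii) If $r$ is extreme in $\mathcal{K}(M)$ and $r(L)=r(M)$ then $T_{\uparrow\uparrow}(r)$ is extreme in $\mathcal{K}(N)$ and, moreover, $T_{\uparrow\uparrow}(r)\approx T_{\uparrow\uparrow}(r_u)$. Conversely, if $T_{\uparrow\uparrow}(r)$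 is extreme in $\mathcal{K}(N)$ then either [$r$ is extreme in $\mathcal{K}(M)$ and $r(L)=r(M)$] or one has $r(L)>r(M)$, $r\in\mathcal{L}(M)$ and $T_{\uparrow\uparrow}(r)\approx[r(L)-r(M)]\cdot v$, where $v\in\mathbb{R}^{\mathcal{P}(N)}$ is given by $v(T)=1$ if $T\subseteq L$ and $v(T)=0$ otherwise, for $T\subseteq N$.
   Context: $\mathcal{P}(N)$ is the power set of $N$; a singleton $\{a\}$ is written $a$ (so for $a\in N$, $a\cap L$ means $\{a\}\cap L$). $\mathbb{R}^{\mathcal{P}(N)}$ is the space of functions $m:\mathcal{P}(N)\to\mathbb{R}$ with scalar product $\langle m,u\rangle=\sum_{A\subseteq N}m(A)u(A)$. A function $m$ is supermodular if $m(A)+m(B)\le m(A\cup B)+m(A\cap B)$ for all $A,B\subseteq N$, modular if equality always holds; $\mathcal{K}(N)$, $\mathcal{L}(N)$ are the classes of supermodular and modular functions. For $m^1,m^2\in\mathbb{R}^{\mathcal{P}(N)}$, $m^1\approx m^2$ (quantitative equivalence) means $m^1-m^2\in\mathcal{L}(N)$. $\mathcal{E}(N)$ is the set of triplets $\langle a,b|C\rangle$ with $a,b\in N$ distinct and $C\subseteq N\setminus\{a,b\}$. For $m\in\mathbb{R}^{\mathcal{P}(N)}$ and pairwise disjoint $A,B,C\subseteq N$, $A\perp B\mid C\ [m]$ means $m(A\cup B\cup C)+m(C)-m(A\cup C)-m(B\cup C)=0$ (trivially true if $A$ or $B$ is empty). The independency model induced by $m\in\mathcal{K}(N)$ is the set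 of $\langle a,b|C\rangle\in\mathcal{E}(N)$ with $a\perp b\mid C\ [m]$. A face of a convex cone $K\subseteq\mathbb{R}^{\mathcal{P}(N)}$ is a set $\{m\in K: k=\langle m,v\rangle\}$, where $v\in\mathbb{R}^{\mathcal{P}(N)}$, $k\in\mathbb{R}$ satisfy $k\le\langle m,v\rangle$ for all $m\in K$. The non-empty faces of $\mathcal{K}(N)$ form a lattice under inclusion with least element $\mathcal{L}(N)$. A function is extreme in $\mathcal{K}(N)$ if it belongs to $\mathcal{K}(N)$ and the smallest face of $\mathcal{K}(N)$ containing it is an atom of this lattice. $\mathcal{K}_u(N)=\{m\in\mathcal{K}(N): m(N)=0,\ m(N\setminus i)=0\ \forall i\in N\}$, and for $m\in\mathbb{R}^{\mathcal{P}(N)}$ the upper standardization is $m_u(T)=m(T)+(|N|-1)m(N)-\sum_{j\in N}m(N\setminus j)+\sum_{i\in T}[m(N\setminus i)-m(N)]$ for $T\subseteq N$. All these definitions are used for other finite sets in place of $N$. The upper replication $T_{\uparrow\uparrow}:\mathbb{R}^{\mathcal{P}(M)}\to\mathbb{R}^{\mathcal{P}(N)}$ is defined, for $S\subseteq N$, by $[T_{\uparrow\uparrow}(r)](S)=r(z\cup(S\cap L))$ if $S\setminus L\ne\emptyset$, and $[T_{\uparrow\uparrow}(r)](S)=r(S)$ if $S\subseteq L$. -}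

module Defs where

open import Level using (0ℓ) renaming (suc to lsuc)
open import Algebra.Bundles using (CommutativeRing)
import Algebra.Definitions.RawMonoid as RawMonoidOps
open import Data.Bool using (if_then_else_)
open import Data.Fin using (Fin)
open import Data.Fin.Subset using (Subset; inside; outside; _∈_; _⊆_; _∪_; _∩_; _─_; ⁅_⁆; ∣_∣)
open import Data.Fin.Subset.Properties using (_∈?_; _⊆?_; nonempty?)
open import Data.Irrelevant using ([_])
open import Data.Nat using (ℕ; zero; suc)
open import Data.Product using (∃; _×_)
open import Data.Refinement using (Refinement; _,_; value)
open import Data.Vec using ([]; _∷_)
open import Function using (_∘_; _⇔_)
open import Relation.Binary.Core using (Rel)
open import Relation.Binary.PropositionalEquality using (_≢_)
open import Relation.Binary.Structures using (IsDecTotalOrder)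
open import Relation.Nullary using (¬_; does; yes; no)
open import Relation.Unary as Pred using (Pred)

-- The real numbers, axiomatised as a Dedekind-complete ordered field, which
-- determines them up to isomorphism.  As in classical mathematics, the order
-- is total and decidable.
record RealNumbers : Set (lsuc 0ℓ) where
  infix 4 _≤_ _<_
  field
    commutativeRing : CommutativeRing 0ℓ 0ℓ

  open CommutativeRing commutativeRing public

  field
    _≤_             : Rel Carrier 0ℓ
    isDecTotalOrder : IsDecTotalOrder _≈_ _≤_
    +-monoʳ-≤       : ∀ x {y z} → y ≤ z → x + y ≤ x + z
    *-nonneg        : ∀ {x y} → 0# ≤ x → 0# ≤ y → 0# ≤ x * y
    1≉0             : ¬ (1# ≈ 0#)
    inverse         : ∀ x → ¬ (x ≈ 0#) → ∃ λ y → x * y ≈ 1#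

  UpperBound : Pred Carrier 0ℓ → Pred Carrier 0ℓ
  UpperBound P b = ∀ x → P x → x ≤ b

  field
    complete : ∀ (P : Pred Carrier 0ℓ) → ∃ P → ∃ (UpperBound P) →
               ∃ λ s → UpperBound P s × (∀ b → UpperBound P b → s ≤ b)

  _<_ : Rel Carrier 0ℓ
  x < y = x ≤ y × ¬ (x ≈ y)

-- All finite sets are subsets of an ambient finite set Fin u, so that sets
-- such as N and M may share elements.
module SetFunctions (ℝ : RealNumbers) (u : ℕ) where

  open RealNumbers ℝ
  open RawMonoidOps +-rawMonoid using (sum)

  -- The proof of S ⊆ N is irrelevant, so elements of 𝒫 N with the same
  -- underlying subset of Fin u are equal.
  𝒫 : Subset u → Set
  𝒫 N = Refinement (Subset u) (λ S → S ⊆ N)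

  ℝ^𝒫 : Subset u → Set
  ℝ^𝒫 N = 𝒫 N → Carrier

  -- m ! S is the value m(S) for S ⊆ N.  The value 0 for other S is a dummy:
  -- the definitions below only evaluate functions inside their domain.
  infixl 9 _!_
  _!_ : ∀ {N} → ℝ^𝒫 N → Subset u → Carrier
  _!_ {N} m S with S ⊆? N
  ... | yes S⊆N = m (S , [ S⊆N ])
  ... | no  _   = 0#

  sumElements : Subset u → (Fin u → Carrier) → Carrier
  sumElements T f = sum (λ i → if does (i ∈? T) then f i else 0#)

  syntax sumElements T (λ i → e) = Σ[ i ∈ T ] e

  sumAllSubsets : ∀ n → (Subset n → Carrier) → Carrier
  sumAllSubsets zero    f = f []
  sumAllSubsets (suc n) f =
    sumAllSubsets n (f ∘ (outside ∷_)) + sumAllSubsets n (f ∘ (inside ∷_))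

  sumSubsets : Subset u → (Subset u → Carrier) → Carrier
  sumSubsets N f = sumAllSubsets u (λ A → if does (A ⊆? N) then f A else 0#)

  syntax sumSubsets N (λ A → e) = Σ[ A ⊆ N ] e

  ⟨_,_⟩ : ∀ {N} → ℝ^𝒫 N → ℝ^𝒫 N → Carrier
  ⟨_,_⟩ {N} m v = Σ[ A ⊆ N ] (m ! A * v ! A)

  infixl 6 _⊖_
  _⊖_ : ∀ {N} → ℝ^𝒫 N → ℝ^𝒫 N → ℝ^𝒫 N
  (m ⊖ v) S = m S - v S

  infixr 7 _·_
  _·_ : ∀ {N} → Carrier → ℝ^𝒫 N → ℝ^𝒫 N
  (c · m) S = c * m S

  -- Supermodular functions
  𝒦 : ∀ N → Pred (ℝ^𝒫 N) 0ℓ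
  𝒦 N m = ∀ A B → A ⊆ N → B ⊆ N → m ! A + m ! B ≤ m ! (A ∪ B) + m ! (A ∩ B)

  -- Modular functions
  ℒ : ∀ N → Pred (ℝ^𝒫 N) 0ℓ
  ℒ N m = ∀ A B → A ⊆ N → B ⊆ N → m ! A + m ! B ≈ m ! (A ∪ B) + m ! (A ∩ B)

  -- Quantitative equivalence
  infix 4 _≋_
  _≋_ : ∀ {N} → Rel (ℝ^𝒫 N) 0ℓ
  _≋_ {N} m¹ m² = ℒ N (m¹ ⊖ m²)

  ℰ : Subset u → Fin u → Fin u → Subset u → Set
  ℰ N a b C = a ∈ N × b ∈ N × a ≢ b × C ⊆ N ─ (⁅ a ⁆ ∪ ⁅ b ⁆)

  -- A ⊥ B ∥ C [ m ], meaningful for pairwise disjoint A, B, C ⊆ N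
  infix 4 _⊥_∥_[_]
  _⊥_∥_[_] : ∀ {N} → Subset u → Subset u → Subset u → ℝ^𝒫 N → Set
  A ⊥ B ∥ C [ m ] =
    m ! (A ∪ B ∪ C) + m ! C - m ! (A ∪ C) - m ! (B ∪ C) ≈ 0#

  IsFace : ∀ {N} → Pred (ℝ^𝒫 N) 0ℓ → Pred (Pred (ℝ^𝒫 N) 0ℓ) 0ℓ
  IsFace {N} K F = ∃ λ (v : ℝ^𝒫 N) → ∃ λ (k : Carrier) →
    (∀ m → K m → k ≤ ⟨ m , v ⟩) ×
    (∀ m → F m ⇔ (K m × k ≈ ⟨ m , v ⟩))

  IsNonemptyFace : ∀ {N} → Pred (ℝ^𝒫 N) 0ℓ → Pred (Pred (ℝ^𝒫 N) 0ℓ) 0ℓ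
  IsNonemptyFace K F = IsFace K F × ∃ F

  -- Atoms of the lattice of non-empty faces of 𝒦 N, whose least element is ℒ N
  IsAtom : ∀ N → Pred (ℝ^𝒫 N) 0ℓ → Set (lsuc 0ℓ)
  IsAtom N F =
    IsNonemptyFace (𝒦 N) F ×
    ℒ N Pred.⊂ F ×
    (∀ G → IsNonemptyFace (𝒦 N) G → G Pred.⊂ F → G Pred.≐ ℒ N)

  IsSmallestFaceOf : ∀ {N} → Pred (ℝ^𝒫 N) 0ℓ → ℝ^𝒫 N → Pred (ℝ^𝒫 N) 0ℓ → Set (lsuc 0ℓ)
  IsSmallestFaceOf K m F =
    IsFace K F × F m × (∀ G → IsFace K G → G m → F Pred.⊆ G)

  Extreme : ∀ N → Pred (ℝ^𝒫 N) (lsuc 0ℓ)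
  Extreme N m = 𝒦 N m × ∃ λ F → IsSmallestFaceOf (𝒦 N) m F × IsAtom N F

  𝒦ᵤ : ∀ N → Pred (ℝ^𝒫 N) 0ℓ
  𝒦ᵤ N m = 𝒦 N m × m ! N ≈ 0# × (∀ i → i ∈ N → m ! (N ─ ⁅ i ⁆) ≈ 0#)

  fromℕ : ℕ → Carrier
  fromℕ zero    = 0#
  fromℕ (suc n) = 1# + fromℕ n

  upperStandardization : ∀ {N} → ℝ^𝒫 N → ℝ^𝒫 N
  upperStandardization {N} m T =
    m T + (fromℕ ∣ N ∣ - 1#) * m ! N
        - Σ[ j ∈ N ] (m ! (N ─ ⁅ j ⁆))
        + Σ[ i ∈ value T ] (m ! (N ─ ⁅ i ⁆) - m ! N)

  -- T↑↑ depends on z ∈ M and on L = M \ z ⊆ N.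
  upperReplication : ∀ {M} N → Fin u → ℝ^𝒫 M → ℝ^𝒫 N
  upperReplication {M} N z r S =
    let L = M ─ ⁅ z ⁆ in
    if does (nonempty? (value S ─ L))
    then r ! (⁅ z ⁆ ∪ (value S ∩ L))
    else r ! value S

  -- Equal to 1 on the subsets of L and to 0 elsewhere
  subsetIndicator : ∀ {N} → Subset u → ℝ^𝒫 N
  subsetIndicator L T = if does (value T ⊆? L) then 1# else 0#

{-# OPTIONS --safe #-}
-- Let Δ m (A, B) = m(A ∪ B) + m(A ∩ B) - m(A) - m(B).  The smallest face of
-- 𝒦 N containing m is cut out by the sum of Δ over the pairs (A, B) with
-- Δ m (A, B) = 0, and as there are only finitely many pairs it consists of the
-- m′ ∈ 𝒦 N with m′ ≼ m, that is, with c m - m′ ∈ 𝒦 N for some c.  Hence m is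
-- extreme iff m ∈ 𝒦 N \ ℒ N and each m′ ∈ 𝒦 N with m′ ≼ m satisfies m′ ∈ ℒ N
-- or m ≼ m′.
--
-- Let ψ : 𝒫 N → 𝒫 M merge x and y into z, and let φ : 𝒫 M → 𝒫 N rename z to x.
-- Then T r = r ∘ ψ and T r ∘ φ = r, where φ is a lattice homomorphism and ψ
-- preserves unions, and Δ (T r) (A, B) exceeds Δ r (ψ A, ψ B) by 0 or by
-- Δ r (ψ A ∩ ψ B, L) + r(L) - r(M).  So when r(L) = r(M), T preserves and reflects
-- 𝒦, ℒ and ≼, and every element of the smallest face of T r is T ρ modulo ℒ N for
-- some ρ: extremality transfers in both directions.  When r(L) > r(M), a positive
-- multiple of the indicator of 𝒫 L, up to a constant, is ≼ T r, so that an extreme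
-- T r is a multiple of it modulo ℒ N.
module Submission where

open import Defs
open import Data.Fin using (Fin)
open import Data.Fin.Subset using (Subset; _∈_; _⊆_; _∪_; _∩_; _─_; ⁅_⁆; ∣_∣; Nonempty; Empty)
open import Data.Nat using (ℕ)
open import Data.Product using (_×_)
open import Data.Sum using (_⊎_)
open import Function using (_⇔_)
open import Relation.Binary.PropositionalEquality using (_≡_; _≢_)

import Algebra.Solver.Ring
open import Algebra.Solver.Ring.AlmostCommutativeRing
  using (AlmostCommutativeRing; fromCommutativeRing; _-Raw-AlmostCommutative⟶_)
open import Data.Bool using (Bool; true; false; _∧_; _∨_; if_then_else_)
open import Data.Bool.Properties
  using (∧-zeroʳ; ∧-identityʳ; ∨-identityʳ; ∨-zeroʳ; ∨-conicalˡ; ∨-conicalʳ)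
  renaming (_≟_ to _≟ᵇ_)
open import Data.Empty using (⊥-elim)
import Data.Fin as Fin
open import Data.Fin using (#_)
open import Data.Fin.Subset using (⊥)
open import Data.Fin.Subset.Properties
  using ( _∈?_; _⊆?_; nonempty?; ⊆-antisym; ⊥⊆; Empty-unique; x∈⁅x⁆; x∈⁅y⁆⇒x≡y
        ; x∈p∪q⁻; x∈p∩q⁻; p⊆p∪q; q⊆p∪q; p∩q⊆p; ∩-zeroʳ
        ; p─q⊆p; x∈p∩q⁺; x∈p∧x∉q⇒x∈p─q; ∉⊥; ∪-idem; ∩-idem
        ; x∈p∪q⁺; x∈p∧x≢y⇒x∈p-y; x∈p⇒∣p-x∣<∣p∣; ∣⊥∣≡0 )
import Data.Integer as ℤ
import Data.Integer.Properties as ℤ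
open import Data.Irrelevant using ([_])
open import Data.List using (List; []; _∷_; _++_)
open import Data.List.Relation.Unary.All as All using (All; []; _∷_)
open import Data.List.Relation.Unary.All.Properties using (++⁺)
open import Data.Maybe using (just; nothing)
open import Data.Nat using (suc; zero; s≤s) renaming (_+_ to _ℕ+_; _<_ to _ℕ<_)
open import Data.Nat.Properties using (n≮0; ≤-pred; <-≤-trans)
open import Data.Product using (∃; _,_; proj₁; proj₂)
open import Data.Refinement using (_,_; value)
open import Data.Sum using (inj₁; inj₂; [_,_]′)
open import Data.Vec using (Vec; []; _∷_; lookup; map; replicate)
open import Data.Vec.Properties
  using ( lookup-zipWith; lookup-map; lookup-replicate; tabulate∘lookup; tabulate-cong; ∷-injectiveʳ; ≡-dec
        ; zipWith-replicate; []=⇒lookup; lookup⇒[]=)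
open import Function using (_∘_; _⟨_⟩_; mk⇔; Equivalence)
open import Function.Properties.Equivalence using () renaming (trans to ⇔-trans)
open import Relation.Binary.Definitions using (WeaklyDecidable)
open import Relation.Binary.Structures using (IsDecTotalOrder)
import Relation.Binary.PropositionalEquality as ≡
open import Relation.Nullary using (¬_; Dec; yes; no; does)
open import Relation.Nullary.Decidable using (_×-dec_; _→-dec_; True; toWitness; map′)
open import Relation.Unary using (Pred)

-- Faces are arbitrary predicates given by a vector and a constant, which makes them awkward to
-- transport along `T`; passing to `≼` removes them before `T` enters. The obstacle to the transfer
-- is that `T` does not respect equivalence modulo modular functions: as Δ (T r) (L ∪ x, L ∪ y) =
-- r(L) - r(M), a modular r has a modular replication only if r(L) = r(M). So a representative has
-- to be chosen in each class. Subtracting a multiple of the indicator of z ∈ S leaves Δ r alone and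
-- gives r(L) - r(M) any prescribed value. In the other direction, a function m on N has four values
-- on the sets D, D ∪ x, D ∪ y, D ∪ {x,y} with D ⊆ L, while a replication has only two. The two
-- missing relations come from the pairs (D ∪ {x,y}, L ∪ x) and (D ∪ {x,y}, L ∪ y), on which Δ (T r)
-- vanishes for every r.

module OrderedField (ℝ : RealNumbers) where
  open RealNumbers ℝ
  open IsDecTotalOrder isDecTotalOrder public
    using (_≟_; antisym; total; ≤-respˡ-≈; ≤-respʳ-≈)
    renaming (refl to ≤-refl; reflexive to ≤-reflexive; trans to ≤-trans)
  open import Algebra.Properties.Monoid.Mult +-monoid using (×-homo-+) renaming (_×_ to _•_)
  open import Algebra.Properties.Semiring.Mult semiring using (×1-homo-*)
  open import Algebra.Properties.Ring ring
    using (-0#≈0#; -‿involutive; -‿+-comm; -‿distribˡ-*; -‿distribʳ-*)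
  open import Relation.Binary.Reasoning.Setoid setoid

  -- Integers serve as coefficients of the ring solver: their equality computes, so cancellations
  -- such as x - x are recognised, whereas equality in the abstract field never reduces.
  fromℤ : ℤ.ℤ → Carrier
  fromℤ (ℤ.+ n)      = n • 1#
  fromℤ (ℤ.-[1+ n ]) = - (suc n • 1#)

  fromℤ-⊖ : ∀ m n → fromℤ (m ℤ.⊖ n) ≈ m • 1# - n • 1#
  fromℤ-⊖ m       zero    = sym (trans (+-congˡ -0#≈0#) (+-identityʳ _))
  fromℤ-⊖ zero    (suc n) = sym (+-identityˡ _)
  fromℤ-⊖ (suc m) (suc n) = begin
    fromℤ (suc m ℤ.⊖ suc n)                  ≡⟨ ≡.cong fromℤ (ℤ.[1+m]⊖[1+n]≡m⊖n m n) ⟩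
    fromℤ (m ℤ.⊖ n)                          ≈⟨ fromℤ-⊖ m n ⟩
    m • 1# - n • 1#                          ≈⟨ +-congʳ (+-identityˡ _) ⟨
    0# + m • 1# - n • 1#                     ≈⟨ +-congʳ (+-congʳ (-‿inverseʳ 1#)) ⟨
    1# - 1# + m • 1# - n • 1#                ≈⟨ +-congʳ (+-assoc 1# (- 1#) _) ⟩
    1# + (- 1# + m • 1#) - n • 1#            ≈⟨ +-congʳ (+-congˡ (+-comm (- 1#) _)) ⟩
    1# + (m • 1# - 1#) - n • 1#              ≈⟨ +-congʳ (+-assoc 1# _ (- 1#)) ⟨
    suc m • 1# - 1# - n • 1#                 ≈⟨ +-assoc _ _ _ ⟩
    suc m • 1# + (- 1# - n • 1#)             ≈⟨ +-congˡ (-‿+-comm 1# _) ⟩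
    suc m • 1# - suc n • 1#                  ∎

  fromℤ-+ : ∀ i j → fromℤ (i ℤ.+ j) ≈ fromℤ i + fromℤ j
  fromℤ-+ (ℤ.+ m)      (ℤ.+ n)      = ×-homo-+ 1# m n
  fromℤ-+ (ℤ.+ m)      (ℤ.-[1+ n ]) = fromℤ-⊖ m (suc n)
  fromℤ-+ (ℤ.-[1+ m ]) (ℤ.+ n)      = trans (fromℤ-⊖ n (suc m)) (+-comm _ _)
  fromℤ-+ (ℤ.-[1+ m ]) (ℤ.-[1+ n ]) = begin
    - (suc (suc m ℕ+ n) • 1#)       ≡⟨ ≡.cong (λ k → - (suc k • 1#)) (≡.sym (+-suc m n)) ⟩
    - ((suc m ℕ+ suc n) • 1#)       ≈⟨ -‿cong (×-homo-+ 1# (suc m) (suc n)) ⟩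
    - (suc m • 1# + suc n • 1#)     ≈⟨ -‿+-comm _ _ ⟨
    - (suc m • 1#) - suc n • 1#     ∎
    where open import Data.Nat.Properties using (+-suc)

  fromℤ-neg : ∀ i → fromℤ (ℤ.- i) ≈ - fromℤ i
  fromℤ-neg (ℤ.+ zero)   = sym -0#≈0#
  fromℤ-neg (ℤ.+ suc n)  = refl
  fromℤ-neg (ℤ.-[1+ n ]) = sym (-‿involutive _)

  fromℤ-pos-* : ∀ m j → fromℤ (ℤ.+ m ℤ.* j) ≈ m • 1# * fromℤ j
  fromℤ-pos-* m (ℤ.+ n) = begin
    fromℤ (ℤ.+ m ℤ.* ℤ.+ n)    ≡⟨ ≡.cong fromℤ (ℤ.pos-* m n) ⟨
    (m ℕ* n) • 1#              ≈⟨ ×1-homo-* m n ⟩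
    m • 1# * (n • 1#)          ∎
    where open import Data.Nat using () renaming (_*_ to _ℕ*_)
  fromℤ-pos-* m (ℤ.-[1+ n ]) = begin
    fromℤ (ℤ.+ m ℤ.* ℤ.-[1+ n ])       ≡⟨ ≡.cong fromℤ (ℤ.neg-distribʳ-* (ℤ.+ m) (ℤ.+ suc n)) ⟨
    fromℤ (ℤ.- (ℤ.+ m ℤ.* ℤ.+ suc n))  ≈⟨ fromℤ-neg (ℤ.+ m ℤ.* ℤ.+ suc n) ⟩
    - fromℤ (ℤ.+ m ℤ.* ℤ.+ suc n)      ≈⟨ -‿cong (fromℤ-pos-* m (ℤ.+ suc n)) ⟩
    - (m • 1# * (suc n • 1#))          ≈⟨ -‿distribʳ-* _ _ ⟩
    m • 1# * - (suc n • 1#)            ∎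

  fromℤ-* : ∀ i j → fromℤ (i ℤ.* j) ≈ fromℤ i * fromℤ j
  fromℤ-* (ℤ.+ m)      j = fromℤ-pos-* m j
  fromℤ-* (ℤ.-[1+ m ]) j = begin
    fromℤ (ℤ.-[1+ m ] ℤ.* j)        ≡⟨ ≡.cong fromℤ (ℤ.neg-distribˡ-* (ℤ.+ suc m) j) ⟨
    fromℤ (ℤ.- (ℤ.+ suc m ℤ.* j))   ≈⟨ fromℤ-neg (ℤ.+ suc m ℤ.* j) ⟩
    - fromℤ (ℤ.+ suc m ℤ.* j)       ≈⟨ -‿cong (fromℤ-pos-* (suc m) j) ⟩
    - (suc m • 1# * fromℤ j)        ≈⟨ -‿distribˡ-* _ _ ⟩
    - (suc m • 1#) * fromℤ j        ∎

  almostCommutativeRing : AlmostCommutativeRing _ _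
  almostCommutativeRing = fromCommutativeRing commutativeRing

  fromℤ-homomorphism : ℤ.+-*-rawRing -Raw-AlmostCommutative⟶ almostCommutativeRing
  fromℤ-homomorphism = record
    { ⟦_⟧    = fromℤ
    ; +-homo = fromℤ-+
    ; *-homo = fromℤ-*
    ; -‿homo = fromℤ-neg
    ; 0-homo = refl
    ; 1-homo = +-identityʳ 1#
    }

  fromℤ-≟ : WeaklyDecidable (λ i j → fromℤ i ≈ fromℤ j)
  fromℤ-≟ i j with i ℤ.≟ j
  ... | yes ≡.refl = just refl
  ... | no _       = nothing

  open Algebra.Solver.Ring ℤ.+-*-rawRing almostCommutativeRing fromℤ-homomorphism fromℤ-≟ public
    using (solve; _:+_; _:*_; _:-_; :-_; _:=_; con)

  ≤-resp : ∀ {a b c d} → a ≈ c → b ≈ d → a ≤ b → c ≤ d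
  ≤-resp a≈c b≈d a≤b = ≤-respˡ-≈ a≈c (≤-respʳ-≈ b≈d a≤b)

  x≤y⇒0≤y-x : ∀ {x y} → x ≤ y → 0# ≤ y - x
  x≤y⇒0≤y-x {x} {y} x≤y = ≤-resp (-‿inverseˡ x) (+-comm (- x) y) (+-monoʳ-≤ (- x) x≤y)

  0≤y-x⇒x≤y : ∀ {x y} → 0# ≤ y - x → x ≤ y
  0≤y-x⇒x≤y {x} {y} 0≤y-x = ≤-resp (+-identityʳ x)
    (solve 2 (λ x y → x :+ (y :- x) := y) refl x y) (+-monoʳ-≤ x 0≤y-x)

  x-y≈0⇒x≈y : ∀ {x y} → x - y ≈ 0# → x ≈ y
  x-y≈0⇒x≈y {x} {y} x-y≈0 = begin
    x          ≈⟨ solve 2 (λ x y → x := (x :- y) :+ y) refl x y ⟩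
    x - y + y  ≈⟨ +-congʳ x-y≈0 ⟩
    0# + y     ≈⟨ +-identityˡ y ⟩
    y          ∎

  x≈y⇒x-y≈0 : ∀ {x y} → x ≈ y → x - y ≈ 0#
  x≈y⇒x-y≈0 {y = y} x≈y = trans (+-congʳ x≈y) (-‿inverseʳ y)

  +-nonneg : ∀ {x y} → 0# ≤ x → 0# ≤ y → 0# ≤ x + y
  +-nonneg {x} 0≤x 0≤y = ≤-trans 0≤x (≤-respˡ-≈ (+-identityʳ x) (+-monoʳ-≤ x 0≤y))

  0≤1 : 0# ≤ 1#
  0≤1 with total 0# 1#
  ... | inj₁ 0≤1 = 0≤1
  ... | inj₂ 1≤0 = ≤-respʳ-≈ [0-1]²≈1 (*-nonneg (x≤y⇒0≤y-x 1≤0) (x≤y⇒0≤y-x 1≤0))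
    where
    [0-1]²≈1 : (0# - 1#) * (0# - 1#) ≈ 1#
    [0-1]²≈1 = trans (solve 1 (λ x → (con ℤ.0ℤ :- x) :* (con ℤ.0ℤ :- x) := x :* x) refl 1#)
                     (*-identityʳ 1#)

  +-nonneg-≈0 : ∀ {x y} → 0# ≤ x → 0# ≤ y → x + y ≈ 0# → x ≈ 0# × y ≈ 0#
  +-nonneg-≈0 {x} {y} 0≤x 0≤y x+y≈0 = x≈0 , y≈0
    where
    x≈0 : x ≈ 0#
    x≈0 = antisym (≤-resp (+-identityʳ x) x+y≈0 (+-monoʳ-≤ x 0≤y)) 0≤x
    y≈0 : y ≈ 0#
    y≈0 = trans (sym (+-identityˡ y)) (trans (+-congʳ (sym x≈0)) x+y≈0)

-- Identities between sets that hold under hypotheses of the same kind are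
-- decided pointwise, by evaluating all Boolean assignments to the variables.
module SetIdentities where
  infixr 7 _⊓_
  infixr 6 _⊔_
  infixl 5 _∖_
  infix  4 _≗_

  data Expr (n : ℕ) : Set where
    var         : Fin n → Expr n
    const       : Bool → Expr n
    _⊔_ _⊓_ _∖_ : Expr n → Expr n → Expr n

  data Equation (n : ℕ) : Set where
    _≗_ : Expr n → Expr n → Equation n

  -- The match is on the second argument, as in `─`, so that both reduce on the same patterns.
  diff : Bool → Bool → Bool
  diff a true  = false
  diff a false = a

  evalᵇ : ∀ {n} → Expr n → Vec Bool n → Bool
  evalᵇ (var i) ρ = lookup ρ i
  evalᵇ (const b) ρ = b
  evalᵇ (d ⊔ e) ρ = evalᵇ d ρ ∨ evalᵇ e ρ
  evalᵇ (d ⊓ e) ρ = evalᵇ d ρ ∧ evalᵇ e ρ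
  evalᵇ (d ∖ e) ρ = diff (evalᵇ d ρ) (evalᵇ e ρ)

  eval : ∀ {n u} → Expr n → Vec (Subset u) n → Subset u
  eval (var i) ρ = lookup ρ i
  eval (const b) ρ = replicate _ b
  eval (d ⊔ e) ρ = eval d ρ ∪ eval e ρ
  eval (d ⊓ e) ρ = eval d ρ ∩ eval e ρ
  eval (d ∖ e) ρ = eval d ρ ─ eval e ρ

  lookup-─ : ∀ {u} (i : Fin u) p q → lookup (p ─ q) i ≡ diff (lookup p i) (lookup q i)
  lookup-─ Fin.zero    (a ∷ p) (true ∷ q)  = ≡.refl
  lookup-─ Fin.zero    (a ∷ p) (false ∷ q) = ≡.refl
  lookup-─ (Fin.suc i) (a ∷ p) (b ∷ q)     = lookup-─ i p q

  lookup-eval : ∀ {n u} (e : Expr n) (ρ : Vec (Subset u) n) i →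
                lookup (eval e ρ) i ≡ evalᵇ e (map (λ p → lookup p i) ρ)
  lookup-eval (var j) ρ i = ≡.sym (lookup-map j (λ p → lookup p i) ρ)
  lookup-eval (const b) ρ i = lookup-replicate i b
  lookup-eval (d ⊔ e) ρ i = ≡.trans (lookup-zipWith _∨_ i (eval d ρ) (eval e ρ))
                                    (≡.cong₂ _∨_ (lookup-eval d ρ i) (lookup-eval e ρ i))
  lookup-eval (d ⊓ e) ρ i = ≡.trans (lookup-zipWith _∧_ i (eval d ρ) (eval e ρ))
                                    (≡.cong₂ _∧_ (lookup-eval d ρ i) (lookup-eval e ρ i))
  lookup-eval (d ∖ e) ρ i = ≡.trans (lookup-─ i (eval d ρ) (eval e ρ))
                                    (≡.cong₂ diff (lookup-eval d ρ i) (lookup-eval e ρ i))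

  Holds : ∀ {n u} → Vec (Subset u) n → Equation n → Set
  Holds ρ (d ≗ e) = eval d ρ ≡ eval e ρ

  Holdsᵇ : ∀ {n} → Vec Bool n → Equation n → Set
  Holdsᵇ ρ (d ≗ e) = evalᵇ d ρ ≡ evalᵇ e ρ

  holdsᵇ? : ∀ {n} (ρ : Vec Bool n) q → Dec (Holdsᵇ ρ q)
  holdsᵇ? ρ (d ≗ e) = evalᵇ d ρ ≟ᵇ evalᵇ e ρ

  Tautology : ∀ {n} → List (Equation n) → Equation n → Set
  Tautology hs q = ∀ ρ → All (Holdsᵇ ρ) hs → Holdsᵇ ρ q

  allAssignments? : ∀ {n} {P : Vec Bool n → Set} → (∀ ρ → Dec (P ρ)) → Dec (∀ ρ → P ρ)
  allAssignments? {zero}  P? = map′ (λ { p [] → p }) (λ p → p []) (P? [])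
  allAssignments? {suc n} {P} P?
    with allAssignments? (λ ρ → P? (true ∷ ρ)) | allAssignments? (λ ρ → P? (false ∷ ρ))
  ... | yes p | yes q = yes λ { (true ∷ ρ) → p ρ ; (false ∷ ρ) → q ρ }
  ... | no ¬p | _     = no λ p → ¬p λ ρ → p (true ∷ ρ)
  ... | yes _ | no ¬q = no λ q → ¬q λ ρ → q (false ∷ ρ)

  tautology? : ∀ {n} (hs : List (Equation n)) q → Dec (Tautology hs q)
  tautology? hs q = allAssignments? λ ρ → All.all? (holdsᵇ? ρ) hs →-dec holdsᵇ? ρ q

  holds-pointwise : ∀ {n u} (ρ : Vec (Subset u) n) q → Holds ρ q →
                    ∀ i → Holdsᵇ (map (λ p → lookup p i) ρ) q
  holds-pointwise ρ (d ≗ e) h i =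
    ≡.trans (≡.sym (lookup-eval d ρ i)) (≡.trans (≡.cong (λ p → lookup p i) h) (lookup-eval e ρ i))

  ≡-pointwise : ∀ {u} {p q : Subset u} → (∀ i → lookup p i ≡ lookup q i) → p ≡ q
  ≡-pointwise {p = p} {q} h =
    ≡.trans (≡.sym (tabulate∘lookup p)) (≡.trans (tabulate-cong h) (tabulate∘lookup q))

  -- All the operations act coordinatewise, so at each index the hypotheses become Boolean equations
  -- and the tautology applies there. The implicit `True` argument is found by running `tautology?`
  -- during type checking.
  entails : ∀ {n u} (hs : List (Equation n)) q {_ : True (tautology? hs q)}
            (ρ : Vec (Subset u) n) → All (Holds ρ) hs → Holds ρ q
  entails hs q@(d ≗ e) {t} ρ hyps = ≡-pointwise λ i →
    ≡.trans (lookup-eval d ρ i) (≡.trans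
      (toWitness t _ (All.map (λ {q} h → holds-pointwise ρ q h i) hyps))
      (≡.sym (lookup-eval e ρ i)))

-- Supermodular and modular functions in terms of Δ.

module SupermodularFunctions (ℝ : RealNumbers) (u : ℕ) where
  open RealNumbers ℝ
  open OrderedField ℝ
  open SetFunctions ℝ u
  open import Algebra.Definitions.RawMonoid +-rawMonoid using (sum)

  ∪-⊆ : ∀ {A B N : Subset u} → A ⊆ N → B ⊆ N → A ∪ B ⊆ N
  ∪-⊆ {A} {B} A⊆N B⊆N i∈ = [ A⊆N , B⊆N ]′ (x∈p∪q⁻ A B i∈)

  ∩-⊆ : ∀ {A B N : Subset u} → A ⊆ N → A ∩ B ⊆ N
  ∩-⊆ {A} {B} A⊆N i∈ = A⊆N (p∩q⊆p A B i∈)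

  !-eval : ∀ {N} (m : ℝ^𝒫 N) {S} (S⊆N : S ⊆ N) → m ! S ≡ m (S , [ S⊆N ])
  !-eval {N} m {S} S⊆N with S ⊆? N
  ... | yes _   = ≡.refl
  ... | no  S⊈N = ⊥-elim (S⊈N S⊆N)

  restrict : ∀ N → (Subset u → Carrier) → ℝ^𝒫 N
  restrict N f S = f (value S)

  restrict-! : ∀ {N} f {S} → S ⊆ N → restrict N f ! S ≡ f S
  restrict-! f S⊆N = !-eval (restrict _ f) S⊆N

  ·⊖-! : ∀ {N} c (m m′ : ℝ^𝒫 N) S → (c · m ⊖ m′) ! S ≈ c * m ! S - m′ ! S
  ·⊖-! {N} c m m′ S with S ⊆? N
  ... | yes _ = refl
  ... | no  _ = sym (trans (+-congʳ (zeroʳ c)) (-‿inverseʳ 0#))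

  ⊖-! : ∀ {N} (m m′ : ℝ^𝒫 N) S → (m ⊖ m′) ! S ≈ m ! S - m′ ! S
  ⊖-! {N} m m′ S with S ⊆? N
  ... | yes _ = refl
  ... | no  _ = sym (-‿inverseʳ 0#)

  -- Taken of functions on all subsets of the ambient set, so that it applies alike to `m !_`, to
  -- weights and to composites with `φ`.
  Δ : (Subset u → Carrier) → Subset u → Subset u → Carrier
  Δ f A B = f (A ∪ B) + f (A ∩ B) - f A - f B

  Δ-lin : ∀ c f g A B → Δ (λ S → c * f S - g S) A B ≈ c * Δ f A B - Δ g A B
  Δ-lin c f g A B = solve 9
    (λ c p q r s p′ q′ r′ s′ →
      (c :* p :- p′) :+ (c :* q :- q′) :- (c :* r :- r′) :- (c :* s :- s′)
      := c :* (p :+ q :- r :- s) :- (p′ :+ q′ :- r′ :- s′))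
    refl c (f (A ∪ B)) (f (A ∩ B)) (f A) (f B) (g (A ∪ B)) (g (A ∩ B)) (g A) (g B)

  Δ-+ : ∀ f g A B → Δ (λ S → f S + g S) A B ≈ Δ f A B + Δ g A B
  Δ-+ f g A B = solve 8
    (λ p q r s p′ q′ r′ s′ → (p :+ p′) :+ (q :+ q′) :- (r :+ r′) :- (s :+ s′)
      := (p :+ q :- r :- s) :+ (p′ :+ q′ :- r′ :- s′))
    refl (f (A ∪ B)) (f (A ∩ B)) (f A) (f B) (g (A ∪ B)) (g (A ∩ B)) (g A) (g B)

  +-cong₄ : ∀ {p q r s p′ q′ r′ s′} → p ≈ p′ → q ≈ q′ → r ≈ r′ → s ≈ s′ →
            p + q - r - s ≈ p′ + q′ - r′ - s′
  +-cong₄ p q r s = +-cong (+-cong (+-cong p q) (-‿cong r)) (-‿cong s)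

  Δ-cong : ∀ {f g} → (∀ S → f S ≈ g S) → ∀ A B → Δ f A B ≈ Δ g A B
  Δ-cong f≈g A B = +-cong₄ (f≈g _) (f≈g _) (f≈g _) (f≈g _)

  Δ-cong-⊆ : ∀ {N f g} → (∀ S → S ⊆ N → f S ≈ g S) →
             ∀ {A B} → A ⊆ N → B ⊆ N → Δ f A B ≈ Δ g A B
  Δ-cong-⊆ f≈g {A} {B} A⊆N B⊆N =
    +-cong₄ (f≈g _ (∪-⊆ {A} {B} A⊆N B⊆N)) (f≈g _ (∩-⊆ {A} {B} A⊆N)) (f≈g _ A⊆N) (f≈g _ B⊆N)

  Δ-·⊖ : ∀ {N} c (m m′ : ℝ^𝒫 N) A B →
         Δ ((c · m ⊖ m′) !_) A B ≈ c * Δ (m !_) A B - Δ (m′ !_) A B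
  Δ-·⊖ c m m′ A B = trans (Δ-cong (·⊖-! c m m′) A B) (Δ-lin c (m !_) (m′ !_) A B)

  Δ-⊖ : ∀ {N} (m m′ : ℝ^𝒫 N) A B → Δ ((m ⊖ m′) !_) A B ≈ Δ (m !_) A B - Δ (m′ !_) A B
  Δ-⊖ m m′ A B = begin
    Δ ((m ⊖ m′) !_) A B                    ≈⟨ Δ-cong (λ S → trans (⊖-! m m′ S) (+-congʳ (sym (*-identityˡ _)))) A B ⟩
    Δ (λ S → 1# * m ! S - m′ ! S) A B      ≈⟨ Δ-lin 1# (m !_) (m′ !_) A B ⟩
    1# * Δ (m !_) A B - Δ (m′ !_) A B      ≈⟨ +-congʳ (*-identityˡ _) ⟩
    Δ (m !_) A B - Δ (m′ !_) A B           ∎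
    where open import Relation.Binary.Reasoning.Setoid setoid

  private
    Δ-as-difference : ∀ f A B → f (A ∪ B) + f (A ∩ B) - (f A + f B) ≈ Δ f A B
    Δ-as-difference f A B = solve 4 (λ p q r s → p :+ q :- (r :+ s) := p :+ q :- r :- s) refl
      (f (A ∪ B)) (f (A ∩ B)) (f A) (f B)

  module _ {N : Subset u} {m : ℝ^𝒫 N} where

    𝒦⇒0≤Δ : 𝒦 N m → ∀ {A B} → A ⊆ N → B ⊆ N → 0# ≤ Δ (m !_) A B
    𝒦⇒0≤Δ m∈𝒦 {A} {B} A⊆N B⊆N =
      ≤-respʳ-≈ (Δ-as-difference (m !_) A B) (x≤y⇒0≤y-x (m∈𝒦 A B A⊆N B⊆N))

    0≤Δ⇒𝒦 : (∀ {A B} → A ⊆ N → B ⊆ N → 0# ≤ Δ (m !_) A B) → 𝒦 N m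
    0≤Δ⇒𝒦 0≤Δ A B A⊆N B⊆N =
      0≤y-x⇒x≤y (≤-respʳ-≈ (sym (Δ-as-difference (m !_) A B)) (0≤Δ A⊆N B⊆N))

    ℒ⇒Δ≈0 : ℒ N m → ∀ {A B} → A ⊆ N → B ⊆ N → Δ (m !_) A B ≈ 0#
    ℒ⇒Δ≈0 m∈ℒ {A} {B} A⊆N B⊆N =
      trans (sym (Δ-as-difference (m !_) A B)) (x≈y⇒x-y≈0 (sym (m∈ℒ A B A⊆N B⊆N)))

    Δ≈0⇒ℒ : (∀ {A B} → A ⊆ N → B ⊆ N → Δ (m !_) A B ≈ 0#) → ℒ N m
    Δ≈0⇒ℒ Δ≈0 A B A⊆N B⊆N =
      sym (x-y≈0⇒x≈y (trans (Δ-as-difference (m !_) A B) (Δ≈0 A⊆N B⊆N)))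

    ℒ⇒𝒦 : ℒ N m → 𝒦 N m
    ℒ⇒𝒦 m∈ℒ A B A⊆N B⊆N = ≤-reflexive (m∈ℒ A B A⊆N B⊆N)

  Δ-shift : ∀ {N f g k} → (∀ S → S ⊆ N → f S ≈ g S + k S) →
            ∀ {A B} → Δ k A B ≈ 0# → A ⊆ N → B ⊆ N → Δ f A B ≈ Δ g A B
  Δ-shift {N} {f} {g} {k} f≈g+k {A} {B} Δk≈0 A⊆N B⊆N = begin
    Δ f A B                       ≈⟨ Δ-cong-⊆ f≈g+k A⊆N B⊆N ⟩
    Δ (λ S → g S + k S) A B       ≈⟨ Δ-+ g k A B ⟩
    Δ g A B + Δ k A B             ≈⟨ +-congˡ Δk≈0 ⟩
    Δ g A B + 0#                  ≈⟨ +-identityʳ _ ⟩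
    Δ g A B                       ∎
    where open import Relation.Binary.Reasoning.Setoid setoid

  Δ-const : ∀ c A B → Δ (λ _ → c) A B ≈ 0#
  Δ-const c A B = solve 1 (λ c → c :+ c :- c :- c := con ℤ.0ℤ) refl c

  -- The modular function carried by the single element `i`; such weights and constants are the
  -- modular corrections made below.
  weight : Fin u → Carrier → Subset u → Carrier
  weight i c S = if lookup S i then c else 0#

  Δ-weight : ∀ i c A B → Δ (weight i c) A B ≈ 0#
  Δ-weight i c A B
    rewrite lookup-zipWith _∨_ i A B | lookup-zipWith _∧_ i A B
    with lookup A i | lookup B i
  ... | true  | true  = solve 1 (λ c → c :+ c :- c :- c := con ℤ.0ℤ) refl c
  ... | true  | false = solve 1 (λ c → c :+ con ℤ.0ℤ :- c :- con ℤ.0ℤ := con ℤ.0ℤ) refl c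
  ... | false | true  = solve 1 (λ c → c :+ con ℤ.0ℤ :- con ℤ.0ℤ :- c := con ℤ.0ℤ) refl c
  ... | false | false = solve 0 (con ℤ.0ℤ :+ con ℤ.0ℤ :- con ℤ.0ℤ :- con ℤ.0ℤ := con ℤ.0ℤ) refl

  Δ-∑ : ∀ n (f : Fin n → Subset u → Carrier) A B → (∀ i → Δ (f i) A B ≈ 0#) →
        Δ (λ S → sum (λ i → f i S)) A B ≈ 0#
  Δ-∑ zero    f A B _    = Δ-const 0# A B
  Δ-∑ (suc n) f A B Δf≈0 = trans (Δ-+ (f Fin.zero) _ A B) (trans
    (+-cong (Δf≈0 Fin.zero) (Δ-∑ n (f ∘ Fin.suc) A B (Δf≈0 ∘ Fin.suc))) (+-identityˡ 0#))

  does-∈? : ∀ {n} (i : Fin n) S → does (i ∈? S) ≡ lookup S i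
  does-∈? Fin.zero    (true  ∷ S) = ≡.refl
  does-∈? Fin.zero    (false ∷ S) = ≡.refl
  does-∈? (Fin.suc i) (_     ∷ S) = does-∈? i S

  -- As a function of the index set, the sum is a sum of weights, one for each element.
  Δ-sumElements : ∀ f A B → Δ (λ S → sumElements S f) A B ≈ 0#
  Δ-sumElements f A B = Δ-∑ u _ A B λ i → trans
    (Δ-cong (λ S → reflexive (≡.cong (if_then f i else 0#) (does-∈? i S))) A B)
    (Δ-weight i (f i) A B)

  infix 4 _≅_
  -- Quantitative equivalence in terms of `Δ`. Chains of such equalities compose without forming
  -- differences of functions; `≅⇒≋` converts the final results.
  _≅_ : ∀ {N} → ℝ^𝒫 N → ℝ^𝒫 N → Set
  _≅_ {N} m m′ = ∀ {A B} → A ⊆ N → B ⊆ N → Δ (m !_) A B ≈ Δ (m′ !_) A B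

  ≅⇒≋ : ∀ {N} {m m′ : ℝ^𝒫 N} → m ≅ m′ → m ≋ m′
  ≅⇒≋ {m = m} {m′} m≅m′ = Δ≈0⇒ℒ λ {A} {B} A⊆N B⊆N →
    trans (Δ-⊖ m m′ A B) (x≈y⇒x-y≈0 (m≅m′ A⊆N B⊆N))

  infix 4 _≼_
  _≼_ : ∀ {N} → ℝ^𝒫 N → ℝ^𝒫 N → Set
  _≼_ {N} m′ m = ∃ λ c → 𝒦 N (c · m ⊖ m′)

  -- The elements of an extreme ray of 𝒦 N modulo ℒ N, described by the order of the cone.
  Extremal : ∀ N → ℝ^𝒫 N → Set
  Extremal N m = 𝒦 N m × ¬ ℒ N m × (∀ m′ → 𝒦 N m′ → m′ ≼ m → ℒ N m′ ⊎ m ≼ m′)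

  module _ {N : Subset u} {m m′ : ℝ^𝒫 N} (m≅m′ : m ≅ m′) where

    ≅-sym : m′ ≅ m
    ≅-sym A⊆N B⊆N = sym (m≅m′ A⊆N B⊆N)

    ≅-𝒦 : 𝒦 N m → 𝒦 N m′
    ≅-𝒦 m∈𝒦 = 0≤Δ⇒𝒦 λ A⊆N B⊆N → ≤-respʳ-≈ (m≅m′ A⊆N B⊆N) (𝒦⇒0≤Δ m∈𝒦 A⊆N B⊆N)

    ≅-ℒ : ℒ N m → ℒ N m′
    ≅-ℒ m∈ℒ = Δ≈0⇒ℒ λ A⊆N B⊆N → trans (sym (m≅m′ A⊆N B⊆N)) (ℒ⇒Δ≈0 m∈ℒ A⊆N B⊆N)

  ≅-≼ : ∀ {N} {m m′ n n′ : ℝ^𝒫 N} → m ≅ m′ → n ≅ n′ → m ≼ n → m′ ≼ n′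
  ≅-≼ {m = m} {m′} {n} {n′} m≅m′ n≅n′ (c , cn-m∈𝒦) = c , ≅-𝒦 {m = c · n ⊖ m}
    (λ {A} {B} A⊆N B⊆N → trans (Δ-·⊖ c n m A B)
      (trans (+-cong (*-congˡ (n≅n′ A⊆N B⊆N)) (-‿cong (m≅m′ A⊆N B⊆N))) (sym (Δ-·⊖ c n′ m′ A B))))
    cn-m∈𝒦

-- Smallest faces, the order `≼` and extremality.

module Faces (ℝ : RealNumbers) (u : ℕ) where
  open RealNumbers ℝ
  open OrderedField ℝ
  open SetFunctions ℝ u
  open SupermodularFunctions ℝ u
  open import Relation.Binary.Reasoning.Setoid setoid

  _≟ˢ_ : (A B : Subset u) → Dec (A ≡ B)
  _≟ˢ_ = ≡-dec _≟ᵇ_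

  sum-cong : ∀ n {f g} → (∀ A → f A ≈ g A) → sumAllSubsets n f ≈ sumAllSubsets n g
  sum-cong zero    f≈g = f≈g []
  sum-cong (suc n) f≈g = +-cong (sum-cong n (f≈g ∘ (false ∷_))) (sum-cong n (f≈g ∘ (true ∷_)))

  sum-lin : ∀ n c f g → sumAllSubsets n (λ A → c * f A - g A) ≈ c * sumAllSubsets n f - sumAllSubsets n g
  sum-lin zero    c f g = refl
  sum-lin (suc n) c f g = trans
    (+-cong (sum-lin n c (f ∘ (false ∷_)) (g ∘ (false ∷_))) (sum-lin n c (f ∘ (true ∷_)) (g ∘ (true ∷_))))
    (solve 5 (λ c p q p′ q′ → (c :* p :- p′) :+ (c :* q :- q′) := c :* (p :+ q) :- (p′ :+ q′)) refl c _ _ _ _)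

  sum-zero : ∀ n {f} → (∀ A → f A ≈ 0#) → sumAllSubsets n f ≈ 0#
  sum-zero zero    f≈0 = f≈0 []
  sum-zero (suc n) f≈0 = trans
    (+-cong (sum-zero n (f≈0 ∘ (false ∷_))) (sum-zero n (f≈0 ∘ (true ∷_)))) (+-identityˡ 0#)

  sum-nonneg : ∀ n {f} → (∀ A → 0# ≤ f A) → 0# ≤ sumAllSubsets n f
  sum-nonneg zero    0≤f = 0≤f []
  sum-nonneg (suc n) 0≤f = +-nonneg (sum-nonneg n (0≤f ∘ (false ∷_))) (sum-nonneg n (0≤f ∘ (true ∷_)))

  sum-nonneg-≈0 : ∀ n {f} → (∀ A → 0# ≤ f A) → sumAllSubsets n f ≈ 0# → ∀ A → f A ≈ 0#
  sum-nonneg-≈0 zero    0≤f Σ≈0 []          = Σ≈0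
  sum-nonneg-≈0 (suc n) 0≤f Σ≈0 (false ∷ A) = sum-nonneg-≈0 n (0≤f ∘ (false ∷_))
    (proj₁ (+-nonneg-≈0 (sum-nonneg n (0≤f ∘ (false ∷_))) (sum-nonneg n (0≤f ∘ (true ∷_))) Σ≈0)) A
  sum-nonneg-≈0 (suc n) 0≤f Σ≈0 (true ∷ A)  = sum-nonneg-≈0 n (0≤f ∘ (true ∷_))
    (proj₂ (+-nonneg-≈0 (sum-nonneg n (0≤f ∘ (false ∷_))) (sum-nonneg n (0≤f ∘ (true ∷_))) Σ≈0)) A

  sum-single : ∀ n A {f} → (∀ B → B ≢ A → f B ≈ 0#) → sumAllSubsets n f ≈ f A
  sum-single zero    []          f≈0 = refl
  sum-single (suc n) (false ∷ A) f≈0 = trans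
    (+-cong (sum-single n A λ B B≢A → f≈0 (false ∷ B) (B≢A ∘ ∷-injectiveʳ))
            (sum-zero n λ B → f≈0 (true ∷ B) λ ()))
    (+-identityʳ _)
  sum-single (suc n) (true ∷ A)  f≈0 = trans
    (+-cong (sum-zero n λ B → f≈0 (false ∷ B) λ ())
            (sum-single n A λ B B≢A → f≈0 (true ∷ B) (B≢A ∘ ∷-injectiveʳ)))
    (+-identityˡ _)

  module _ {N : Subset u} where

    ⟨⟩-lin : ∀ c (m m′ v : ℝ^𝒫 N) → ⟨ c · m ⊖ m′ , v ⟩ ≈ c * ⟨ m , v ⟩ - ⟨ m′ , v ⟩
    ⟨⟩-lin c m m′ v = trans (sum-cong u term) (sum-lin u c _ _)
      where
      term : ∀ A → (if does (A ⊆? N) then (c · m ⊖ m′) ! A * v ! A else 0#) ≈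
             c * (if does (A ⊆? N) then m ! A * v ! A else 0#) -
             (if does (A ⊆? N) then m′ ! A * v ! A else 0#)
      term A with does (A ⊆? N)
      ... | true  = trans (*-congʳ (·⊖-! c m m′ A))
        (solve 4 (λ c x y v → (c :* x :- y) :* v := c :* (x :* v) :- y :* v) refl c _ _ _)
      ... | false = sym (trans (+-congʳ (zeroʳ c)) (-‿inverseʳ 0#))

    ⟨⟩-comm : ∀ (m v : ℝ^𝒫 N) → ⟨ m , v ⟩ ≈ ⟨ v , m ⟩
    ⟨⟩-comm m v = sum-cong u term
      where
      term : ∀ A → (if does (A ⊆? N) then m ! A * v ! A else 0#) ≈
                   (if does (A ⊆? N) then v ! A * m ! A else 0#)
      term A with does (A ⊆? N)
      ... | true  = *-comm _ _
      ... | false = refl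

    -- A face has to be exhibited by a vector, but the functional needed is a nested sum of values
    -- of Δ. Closure properties of representability assemble its vector along the way.
    Representable : (ℝ^𝒫 N → Carrier) → Set
    Representable φ = ∃ λ v → ∀ m → ⟨ m , v ⟩ ≈ φ m

    rep-cong : ∀ {φ ψ} → (∀ m → φ m ≈ ψ m) → Representable φ → Representable ψ
    rep-cong φ≈ψ (v , v-rep) = v , λ m → trans (v-rep m) (φ≈ψ m)

    rep-lin : ∀ {φ ψ} c → Representable φ → Representable ψ → Representable (λ m → c * φ m - ψ m)
    rep-lin {φ} {ψ} c (v , v-rep) (w , w-rep) = c · v ⊖ w , λ m → begin
      ⟨ m , c · v ⊖ w ⟩            ≈⟨ ⟨⟩-comm m (c · v ⊖ w) ⟩
      ⟨ c · v ⊖ w , m ⟩            ≈⟨ ⟨⟩-lin c v w m ⟩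
      c * ⟨ v , m ⟩ - ⟨ w , m ⟩    ≈⟨ +-cong (*-congˡ (trans (⟨⟩-comm v m) (v-rep m)))
                                             (-‿cong (trans (⟨⟩-comm w m) (w-rep m))) ⟩
      c * φ m - ψ m                ∎

    rep-- : ∀ {φ ψ} → Representable φ → Representable ψ → Representable (λ m → φ m - ψ m)
    rep-- v w = rep-cong (λ m → +-congʳ (*-identityˡ _)) (rep-lin 1# v w)

    rep-+ : ∀ {φ ψ} → Representable φ → Representable ψ → Representable (λ m → φ m + ψ m)
    rep-+ {φ} {ψ} v w = rep-cong
      -- A sum is obtained from differences alone: y - y - y is -y.
      (λ m → solve 2 (λ x y → x :- (y :- y :- y) := x :+ y) refl (φ m) (ψ m))
      (rep-- v (rep-- (rep-- w w) w))

    rep-! : ∀ {A} → A ⊆ N → Representable (_! A)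
    rep-! {A} A⊆N = δ , λ m → trans (sum-single u A (off m)) (on m)
      where
      δ : ℝ^𝒫 N
      δ S = if does (value S ≟ˢ A) then 1# else 0#
      off : ∀ m B → B ≢ A → (if does (B ⊆? N) then m ! B * δ ! B else 0#) ≈ 0#
      off m B B≢A with B ⊆? N
      ... | no  _ = refl
      ... | yes _ with B ≟ˢ A
      ...   | yes B≡A = ⊥-elim (B≢A B≡A)
      ...   | no  _   = zeroʳ _
      on : ∀ m → (if does (A ⊆? N) then m ! A * δ ! A else 0#) ≈ m ! A
      on m with A ⊆? N
      ... | no A⊈N = ⊥-elim (A⊈N A⊆N)
      ... | yes _ with A ≟ˢ A
      ...   | yes _   = *-identityʳ _
      ...   | no A≢A  = ⊥-elim (A≢A ≡.refl)

    rep-0 : Representable (λ _ → 0#)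
    rep-0 = rep-cong (λ _ → -‿inverseʳ _) (rep-- (rep-! (⊥⊆ {p = N})) (rep-! (⊥⊆ {p = N})))

    rep-Δ : ∀ {A B} → A ⊆ N → B ⊆ N → Representable (λ m → Δ (m !_) A B)
    rep-Δ {A} {B} A⊆N B⊆N =
      rep-- (rep-- (rep-+ (rep-! (∪-⊆ {A} {B} A⊆N B⊆N)) (rep-! (∩-⊆ {A} {B} A⊆N))) (rep-! A⊆N)) (rep-! B⊆N)

    rep-sum : ∀ n {φ : Subset n → ℝ^𝒫 N → Carrier} → (∀ A → Representable (φ A)) →
              Representable (λ m → sumAllSubsets n (λ A → φ A m))
    rep-sum zero    φ-rep = φ-rep []
    rep-sum (suc n) φ-rep = rep-+ (rep-sum n (φ-rep ∘ (false ∷_))) (rep-sum n (φ-rep ∘ (true ∷_)))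

    Tight : ℝ^𝒫 N → Subset u → Subset u → Set
    Tight m A B = A ⊆ N × B ⊆ N × Δ (m !_) A B ≈ 0#

    tight? : ∀ m A B → Dec (Tight m A B)
    tight? m A B = (A ⊆? N) ×-dec (B ⊆? N) ×-dec (Δ (m !_) A B ≟ 0#)

    guard : {P : Set} → Dec P → Carrier → Carrier
    guard d x = if does d then x else 0#

    guard-nonneg : ∀ {P : Set} (d : Dec P) {x} → (P → 0# ≤ x) → 0# ≤ guard d x
    guard-nonneg (yes p) 0≤x = 0≤x p
    guard-nonneg (no _)  0≤x = ≤-refl

    guard-≈0 : ∀ {P : Set} (d : Dec P) {x} → (P → x ≈ 0#) → guard d x ≈ 0#
    guard-≈0 (yes p) x≈0 = x≈0 p
    guard-≈0 (no _)  x≈0 = refl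

    guard-≈0⁻¹ : ∀ {P : Set} (d : Dec P) {x} → P → guard d x ≈ 0# → x ≈ 0#
    guard-≈0⁻¹ (yes _) p x≈0 = x≈0
    guard-≈0⁻¹ (no ¬p) p _   = ⊥-elim (¬p p)

    guard-rep : ∀ {P : Set} (d : Dec P) {φ} → (P → Representable φ) → Representable (λ m → guard d (φ m))
    guard-rep (yes p) φ-rep = φ-rep p
    guard-rep (no _)  φ-rep = rep-0

    tightTerm : ℝ^𝒫 N → ℝ^𝒫 N → Subset u → Subset u → Carrier
    tightTerm m m′ A B = guard (tight? m A B) (Δ (m′ !_) A B)

    -- Every term is nonnegative on `𝒦 N`, so there the one equation `tightSum m m′ ≈ 0#` expresses
    -- all the conditions of `faceOf m`.
    tightSum : ℝ^𝒫 N → ℝ^𝒫 N → Carrier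
    tightSum m m′ = sumAllSubsets u λ A → sumAllSubsets u (tightTerm m m′ A)

    tightSum-rep : ∀ m → Representable (tightSum m)
    tightSum-rep m = rep-sum u λ A → rep-sum u λ B →
      guard-rep (tight? m A B) λ (A⊆N , B⊆N , _) → rep-Δ A⊆N B⊆N

    faceOf : ℝ^𝒫 N → Pred (ℝ^𝒫 N) _
    faceOf m m′ = 𝒦 N m′ × (∀ {A B} → Tight m A B → Δ (m′ !_) A B ≈ 0#)

    tightTerm-nonneg : ∀ m {m′} → 𝒦 N m′ → ∀ A B → 0# ≤ tightTerm m m′ A B
    tightTerm-nonneg m m′∈𝒦 A B = guard-nonneg (tight? m A B) λ (A⊆N , B⊆N , _) → 𝒦⇒0≤Δ m′∈𝒦 A⊆N B⊆N

    tightSum-nonneg : ∀ m {m′} → 𝒦 N m′ → 0# ≤ tightSum m m′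
    tightSum-nonneg m m′∈𝒦 = sum-nonneg u λ A → sum-nonneg u (tightTerm-nonneg m m′∈𝒦 A)

    faceOf⇒tightSum≈0 : ∀ {m m′} → faceOf m m′ → tightSum m m′ ≈ 0#
    faceOf⇒tightSum≈0 {m} (_ , tight) = sum-zero u λ A → sum-zero u λ B → guard-≈0 (tight? m A B) tight

    tightSum≈0⇒faceOf : ∀ {m m′} → 𝒦 N m′ → tightSum m m′ ≈ 0# → faceOf m m′
    tightSum≈0⇒faceOf {m} m′∈𝒦 Σ≈0 = m′∈𝒦 , λ {A} {B} t → guard-≈0⁻¹ (tight? m A B) t
      (sum-nonneg-≈0 u (tightTerm-nonneg m m′∈𝒦 A)
        (sum-nonneg-≈0 u (λ A → sum-nonneg u (tightTerm-nonneg m m′∈𝒦 A)) Σ≈0 A) B)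

    -- This decision supplies the two alternatives in `extreme⇒extremal`.
    faceOf? : ∀ m {m′} → 𝒦 N m′ → Dec (faceOf m m′)
    faceOf? m m′∈𝒦 = map′ (tightSum≈0⇒faceOf m′∈𝒦) faceOf⇒tightSum≈0 (tightSum m _ ≟ 0#)

    faceOf-isFace : ∀ m → IsFace (𝒦 N) (faceOf m)
    faceOf-isFace m with tightSum-rep m
    ... | v , v-rep = v , 0#
      , (λ m′ m′∈𝒦 → ≤-respʳ-≈ (sym (v-rep m′)) (tightSum-nonneg m m′∈𝒦))
      , λ m′ → mk⇔
          (λ m′∈F → proj₁ m′∈F , sym (trans (v-rep m′) (faceOf⇒tightSum≈0 m′∈F)))
          (λ (m′∈𝒦 , 0≈) → tightSum≈0⇒faceOf m′∈𝒦 (trans (sym (v-rep m′)) (sym 0≈)))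

    faceOf-refl : ∀ {m} → 𝒦 N m → faceOf m m
    faceOf-refl m∈𝒦 = m∈𝒦 , λ (_ , _ , Δ≈0) → Δ≈0

    -- At a tight pair Δ (c m) is 0, so Δ m′ and -Δ m′ are both nonnegative.
    ≼⇒faceOf : ∀ {m m′} → 𝒦 N m′ → m′ ≼ m → faceOf m m′
    ≼⇒faceOf {m} {m′} m′∈𝒦 (c , cm-m′∈𝒦) = m′∈𝒦 , λ {A} {B} (A⊆N , B⊆N , Δ≈0) →
      antisym
        (0≤y-x⇒x≤y (≤-respʳ-≈ (trans (Δ-·⊖ c m m′ A B) (+-congʳ (trans (*-congˡ Δ≈0) (zeroʳ c))))
          (𝒦⇒0≤Δ cm-m′∈𝒦 A⊆N B⊆N)))
        (𝒦⇒0≤Δ m′∈𝒦 A⊆N B⊆N)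

    -- A maximum over finitely many subsets: the larger of the bounds for the two halves serves for
    -- both.
    uniformBound : ∀ n (P : Carrier → Subset n → Set) →
                   (∀ {c d A} → c ≤ d → P c A → P d A) →
                   (∀ A → ∃ λ c → P c A) → ∃ λ c → ∀ A → P c A
    uniformBound zero    P mono bound = proj₁ (bound []) , λ { [] → proj₂ (bound []) }
    uniformBound (suc n) P mono bound
      with uniformBound n (λ c A → P c (false ∷ A)) mono (bound ∘ (false ∷_))
         | uniformBound n (λ c A → P c (true ∷ A)) mono (bound ∘ (true ∷_))
    ... | c , p | d , q with total c d
    ...   | inj₁ c≤d = d , λ { (false ∷ A) → mono c≤d (p A) ; (true ∷ A) → q A }
    ...   | inj₂ d≤c = c , λ { (false ∷ A) → p A ; (true ∷ A) → mono d≤c (q A) }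

    -- Where Δ m is nonzero, c may be the ratio Δ m′ / Δ m; where it is zero, so is Δ m′ and any c
    -- will do. As Δ m is nonnegative, raising c preserves the bound, and the largest of the
    -- finitely many constants works for all pairs.
    faceOf⇒≼ : ∀ {m m′} → 𝒦 N m → faceOf m m′ → m′ ≼ m
    faceOf⇒≼ {m} {m′} m∈𝒦 (m′∈𝒦 , tight) = proj₁ bound , 0≤Δ⇒𝒦 λ {A} {B} A⊆N B⊆N →
      ≤-respʳ-≈ (sym (Δ-·⊖ (proj₁ bound) m m′ A B)) (x≤y⇒0≤y-x (proj₂ bound A B A⊆N B⊆N))
      where
      Bound : Carrier → Subset u → Subset u → Set
      Bound c A B = A ⊆ N → B ⊆ N → Δ (m′ !_) A B ≤ c * Δ (m !_) A B

      mono : ∀ {c d A B} → c ≤ d → Bound c A B → Bound d A B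
      mono {c} {d} c≤d bound A⊆N B⊆N = ≤-trans (bound A⊆N B⊆N)
        (0≤y-x⇒x≤y (≤-respʳ-≈ (solve 3 (λ d c x → (d :- c) :* x := d :* x :- c :* x) refl d c _)
          (*-nonneg (x≤y⇒0≤y-x c≤d) (𝒦⇒0≤Δ m∈𝒦 A⊆N B⊆N))))

      pairBound : ∀ A B → ∃ λ c → Bound c A B
      pairBound A B with tight? m A B | Δ (m !_) A B ≟ 0#
      ... | yes t | _       = 0# , λ _ _ → ≤-reflexive (trans (tight t) (sym (zeroˡ _)))
      ... | no ¬t | yes Δ≈0 = 0# , λ A⊆N B⊆N → ⊥-elim (¬t (A⊆N , B⊆N , Δ≈0))
      ... | no _  | no Δ≉0  with inverse _ Δ≉0
      ...   | w , Δw≈1 = Δ (m′ !_) A B * w , λ _ _ → ≤-reflexive (sym (begin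
        Δ (m′ !_) A B * w * Δ (m !_) A B    ≈⟨ *-assoc _ _ _ ⟩
        Δ (m′ !_) A B * (w * Δ (m !_) A B)  ≈⟨ *-congˡ (trans (*-comm _ _) Δw≈1) ⟩
        Δ (m′ !_) A B * 1#                  ≈⟨ *-identityʳ _ ⟩
        Δ (m′ !_) A B                       ∎))

      bound : ∃ λ c → ∀ A B → Bound c A B
      bound = uniformBound u (λ c A → ∀ B → Bound c A B) (λ c≤d b B → mono {B = B} c≤d (b B))
        λ A → uniformBound u (λ c → Bound c A) (λ {_} {_} {B} c≤d → mono {A = A} {B} c≤d) (pairBound A)

    -- Testing the bound on m - m gives k ≤ 0, and on 2m, where the functional is 2k, it gives 0 ≤
    -- k. With k = 0 the bound on c m - m′ reads ⟨ m′ , v ⟩ ≤ 0, and the bound on m′ is the reverse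
    -- inequality.
    ≼-∈-face : ∀ {G m m′} → IsFace (𝒦 N) G → G m → 𝒦 N m′ → m′ ≼ m → G m′
    ≼-∈-face {G} {m} {m′} (v , k , k≤ , G⇔) m∈G m′∈𝒦 (c , cm-m′∈𝒦) =
      from (G⇔ m′) (m′∈𝒦 , trans k≈0 (sym (antisym ⟨m′⟩≤0 0≤⟨m′⟩)))
      where
      open Equivalence
      m∈𝒦 = proj₁ (to (G⇔ m) m∈G)
      k≈⟨m⟩ = proj₂ (to (G⇔ m) m∈G)

      k≤0 : k ≤ 0#
      k≤0 = ≤-respʳ-≈
        (trans (⟨⟩-lin 1# m m v) (trans (+-congʳ (*-identityˡ _)) (-‿inverseʳ _)))
        (k≤ (1# · m ⊖ m) (0≤Δ⇒𝒦 λ {A} {B} _ _ → ≤-reflexive (sym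
          (trans (Δ-·⊖ 1# m m A B) (trans (+-congʳ (*-identityˡ _)) (-‿inverseʳ _))))))

      -- Functions are combined only in the form `c · m ⊖ m′`, so 2m is written as 3m - m.
      3· : ∀ x → (1# + 1# + 1#) * x - x ≈ x + x
      3· x = begin
        (1# + 1# + 1#) * x - x          ≈⟨ solve 2 (λ o x → (o :+ o :+ o) :* x :- x
                                             := o :* x :+ o :* x :+ (o :* x :- x)) refl 1# x ⟩
        1# * x + 1# * x + (1# * x - x)  ≈⟨ +-cong (+-cong (*-identityˡ x) (*-identityˡ x))
                                                  (x≈y⇒x-y≈0 (*-identityˡ x)) ⟩
        x + x + 0#                      ≈⟨ +-identityʳ _ ⟩
        x + x                           ∎

      -- The function used is 2m.
      0≤k : 0# ≤ k
      0≤k = ≤-respʳ-≈ (solve 1 (λ k → (k :+ k) :- k := k) refl k) (x≤y⇒0≤y-x (≤-respʳ-≈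
        (begin
          ⟨ (1# + 1# + 1#) · m ⊖ m , v ⟩           ≈⟨ ⟨⟩-lin _ m m v ⟩
          (1# + 1# + 1#) * ⟨ m , v ⟩ - ⟨ m , v ⟩   ≈⟨ 3· _ ⟩
          ⟨ m , v ⟩ + ⟨ m , v ⟩                    ≈⟨ +-cong k≈⟨m⟩ k≈⟨m⟩ ⟨
          k + k                                    ∎)
        (k≤ ((1# + 1# + 1#) · m ⊖ m) (0≤Δ⇒𝒦 λ {A} {B} A⊆N B⊆N →
          ≤-respʳ-≈ (sym (trans (Δ-·⊖ _ m m A B) (3· _)))
            (+-nonneg (𝒦⇒0≤Δ m∈𝒦 A⊆N B⊆N) (𝒦⇒0≤Δ m∈𝒦 A⊆N B⊆N))))))

      k≈0 : k ≈ 0#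
      k≈0 = antisym k≤0 0≤k

      0≤⟨m′⟩ : 0# ≤ ⟨ m′ , v ⟩
      0≤⟨m′⟩ = ≤-respˡ-≈ k≈0 (k≤ m′ m′∈𝒦)

      ⟨m′⟩≤0 : ⟨ m′ , v ⟩ ≤ 0#
      ⟨m′⟩≤0 = 0≤y-x⇒x≤y (≤-resp k≈0
        (trans (⟨⟩-lin c m m′ v) (+-congʳ (trans (*-congˡ (trans (sym k≈⟨m⟩) k≈0)) (zeroʳ c))))
        (k≤ _ cm-m′∈𝒦))

    faceOf-smallest : ∀ {m} → 𝒦 N m → IsSmallestFaceOf (𝒦 N) m (faceOf m)
    faceOf-smallest m∈𝒦 = faceOf-isFace _ , faceOf-refl m∈𝒦 ,
      λ G G-face m∈G m′∈F → ≼-∈-face G-face m∈G (proj₁ m′∈F) (faceOf⇒≼ m∈𝒦 m′∈F)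

    -- The constant 0 suffices, since -m′ is modular along with m′.
    ℒ⇒≼ : ∀ {m m′} → ℒ N m′ → m′ ≼ m
    ℒ⇒≼ {m} {m′} m′∈ℒ = 0# , 0≤Δ⇒𝒦 λ {A} {B} A⊆N B⊆N → ≤-reflexive (sym (begin
      Δ ((0# · m ⊖ m′) !_) A B               ≈⟨ Δ-·⊖ 0# m m′ A B ⟩
      0# * Δ (m !_) A B - Δ (m′ !_) A B      ≈⟨ +-cong (zeroˡ _) (-‿cong (ℒ⇒Δ≈0 m′∈ℒ A⊆N B⊆N)) ⟩
      0# - 0#                                ≈⟨ -‿inverseʳ 0# ⟩
      0#                                     ∎))

    extreme⇒extremal : ∀ {m} → Extreme N m → Extremal N m
    extreme⇒extremal {m} (m∈𝒦 , F , (F-face , m∈F , F-smallest) , (_ , (ℒ⊆F , F⊈ℒ) , atom)) =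
      m∈𝒦 , m∉ℒ , dichotomy
      where
      -- For a modular m every pair is tight, so its smallest face would contain modular functions
      -- only.
      m∉ℒ : ¬ ℒ N m
      m∉ℒ m∈ℒ = F⊈ℒ λ {m′} m′∈F → Δ≈0⇒ℒ λ {A} {B} A⊆N B⊆N →
        proj₂ (F-smallest (faceOf m) (faceOf-isFace m) (faceOf-refl m∈𝒦) m′∈F)
          {A} {B} (A⊆N , B⊆N , ℒ⇒Δ≈0 m∈ℒ A⊆N B⊆N)

      dichotomy : ∀ m′ → 𝒦 N m′ → m′ ≼ m → ℒ N m′ ⊎ m ≼ m′
      dichotomy m′ m′∈𝒦 m′≼m with faceOf? m′ m∈𝒦
      ... | yes m∈F′ = inj₂ (faceOf⇒≼ m′∈𝒦 m∈F′)
      -- The face of m′ lies in F because m′ ≼ m, and it misses m: it is a proper subface of an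
      -- atom.
      ... | no  m∉F′ = inj₁ (proj₁ F′≐ℒ (faceOf-refl m′∈𝒦))
        where
        F′⊆F : ∀ {m″} → faceOf m′ m″ → F m″
        F′⊆F = proj₂ (proj₂ (faceOf-smallest m′∈𝒦)) F F-face (≼-∈-face F-face m∈F m′∈𝒦 m′≼m)
        F′≐ℒ = atom (faceOf m′) (faceOf-isFace m′ , m′ , faceOf-refl m′∈𝒦)
                    (F′⊆F , λ F⊆F′ → m∉F′ (F⊆F′ m∈F))

    -- Let G be a nonempty face properly inside the face of m. An m′ in G with m ≼ m′ would bring m,
    -- and with it the whole face of m, into G; so every m′ in G is modular. Conversely, modular
    -- functions are below every function and hence lie in G.
    extremal⇒extreme : ∀ {m} → Extremal N m → Extreme N m
    extremal⇒extreme {m} (m∈𝒦 , m∉ℒ , dichotomy) =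
      m∈𝒦 , faceOf m , faceOf-smallest m∈𝒦 ,
      (faceOf-isFace m , m , faceOf-refl m∈𝒦) ,
      (ℒ⊆face (faceOf-isFace m) (faceOf-refl m∈𝒦) , λ F⊆ℒ → m∉ℒ (F⊆ℒ (faceOf-refl m∈𝒦))) ,
      λ G (G-face , g , g∈G) (G⊆F , F⊈G) →
        (λ {m′} m′∈G → [ (λ m′∈ℒ → m′∈ℒ)
                       , (λ m≼m′ → ⊥-elim (F⊈G λ {m″} →
                           proj₂ (proj₂ (faceOf-smallest m∈𝒦)) G G-face
                             (≼-∈-face G-face m′∈G m∈𝒦 m≼m′))) ]′
            (dichotomy m′ (proj₁ (G⊆F m′∈G)) (faceOf⇒≼ m∈𝒦 (G⊆F m′∈G)))) ,
        ℒ⊆face G-face g∈G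
      where
      ℒ⊆face : ∀ {G g} → IsFace (𝒦 N) G → G g → ∀ {m′} → ℒ N m′ → G m′
      ℒ⊆face G-face g∈G m′∈ℒ = ≼-∈-face G-face g∈G (ℒ⇒𝒦 m′∈ℒ) (ℒ⇒≼ m′∈ℒ)

-- Coordinates for the subsets of M and N.

module Replication (ℝ : RealNumbers) (u : ℕ) (N M : Subset u) (z x y : Fin u)
  (z∈M : z ∈ M) (L⊆N : M ─ ⁅ z ⁆ ⊆ N) (N─L≡xy : N ─ (M ─ ⁅ z ⁆) ≡ ⁅ x ⁆ ∪ ⁅ y ⁆) (x≢y : x ≢ y) where
  open RealNumbers ℝ
  open OrderedField ℝ
  open SetFunctions ℝ u
  open SupermodularFunctions ℝ u
  open SetIdentities
  open Faces ℝ u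

  L X Y Z : Subset u
  L = M ─ ⁅ z ⁆
  X = ⁅ x ⁆
  Y = ⁅ y ⁆
  Z = ⁅ z ⁆

  ⊆⇒∪≡ : ∀ {p q : Subset u} → p ⊆ q → p ∪ q ≡ q
  ⊆⇒∪≡ {p} {q} p⊆q = ⊆-antisym ([ p⊆q , (λ i∈q → i∈q) ]′ ∘ x∈p∪q⁻ p q) (q⊆p∪q p q)

  ∪≡⇒⊆ : ∀ {p q : Subset u} → p ∪ q ≡ q → p ⊆ q
  ∪≡⇒⊆ {p} {q} p∪q≡q i∈p = ≡.subst (_ ∈_) p∪q≡q (p⊆p∪q q i∈p)

  ⁅⁆-⊆ : ∀ {i} {p : Subset u} → i ∈ p → ⁅ i ⁆ ⊆ p
  ⁅⁆-⊆ {i} i∈p j∈⁅i⁆ = ≡.subst (_∈ _) (≡.sym (x∈⁅y⁆⇒x≡y i j∈⁅i⁆)) i∈p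

  -- In every call of `identity`, variables 0 to 3 stand for L, X, Y, Z, and the sets listed
  -- explicitly are numbered from 4.
  𝐋 𝐗 𝐘 𝐙 : ∀ {n} → Expr (4 ℕ+ n)
  𝐋 = var (# 0)
  𝐗 = var (# 1)
  𝐘 = var (# 2)
  𝐙 = var (# 3)

  𝐚 : ∀ {n} → Expr (5 ℕ+ n)
  𝐚 = var (# 4)

  𝐛 : ∀ {n} → Expr (6 ℕ+ n)
  𝐛 = var (# 5)

  𝐜 : ∀ {n} → Expr (7 ℕ+ n)
  𝐜 = var (# 6)

  -- Nothing relates Z to X or Y, because z may coincide with x or y.
  disjointness : ∀ {n} → List (Equation (4 ℕ+ n))
  disjointness = (𝐋 ⊓ 𝐗 ≗ const false) ∷ (𝐋 ⊓ 𝐘 ≗ const false) ∷ (𝐗 ⊓ 𝐘 ≗ const false) ∷ (𝐋 ⊓ 𝐙 ≗ const false) ∷ []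

  ⁅x⁆∩⁅y⁆≡⊥ : X ∩ Y ≡ ⊥
  ⁅x⁆∩⁅y⁆≡⊥ = Empty-unique λ (i , i∈) →
    x≢y (≡.trans (≡.sym (x∈⁅y⁆⇒x≡y x (proj₁ (x∈p∩q⁻ X Y i∈)))) (x∈⁅y⁆⇒x≡y y (proj₂ (x∈p∩q⁻ X Y i∈))))

  disjoint : ∀ {n} (ρ : Vec (Subset u) n) → All (Holds (L ∷ X ∷ Y ∷ Z ∷ ρ)) disjointness
  disjoint ρ =
      entails ((var (# 0) ∖ var (# 1) ≗ var (# 2) ⊔ var (# 3)) ∷ []) (var (# 1) ⊓ var (# 2) ≗ const false)
        (N ∷ L ∷ X ∷ Y ∷ []) (N─L≡xy ∷ [])
    ∷ entails ((var (# 0) ∖ var (# 1) ≗ var (# 2) ⊔ var (# 3)) ∷ []) (var (# 1) ⊓ var (# 3) ≗ const false)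
        (N ∷ L ∷ X ∷ Y ∷ []) (N─L≡xy ∷ [])
    ∷ ⁅x⁆∩⁅y⁆≡⊥
    ∷ entails [] ((var (# 0) ∖ var (# 1)) ⊓ var (# 1) ≗ const false) (M ∷ Z ∷ []) []
    ∷ []

  identity : ∀ {n} (hs : List (Equation (4 ℕ+ n))) q {_ : True (tautology? (disjointness ++ hs) q)}
             (ρ : Vec (Subset u) n) → All (Holds (L ∷ X ∷ Y ∷ Z ∷ ρ)) hs → Holds (L ∷ X ∷ Y ∷ Z ∷ ρ) q
  identity hs q {t} ρ hyps = entails (disjointness ++ hs) q {t} (L ∷ X ∷ Y ∷ Z ∷ ρ) (++⁺ (disjoint ρ) hyps)

  M≡ : M ≡ L ∪ Z
  M≡ = entails ((var (# 1) ⊔ var (# 0) ≗ var (# 0)) ∷ [])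
         (var (# 0) ≗ (var (# 0) ∖ var (# 1)) ⊔ var (# 1)) (M ∷ Z ∷ []) (⊆⇒∪≡ (⁅⁆-⊆ z∈M) ∷ [])

  N≡ : N ≡ L ∪ (X ∪ Y)
  N≡ = entails ((var (# 0) ∖ var (# 1) ≗ var (# 2) ⊔ var (# 3)) ∷ (var (# 1) ⊔ var (# 0) ≗ var (# 0)) ∷ [])
         (var (# 0) ≗ var (# 1) ⊔ (var (# 2) ⊔ var (# 3))) (N ∷ L ∷ X ∷ Y ∷ [])
         (N─L≡xy ∷ ⊆⇒∪≡ L⊆N ∷ [])

  -- Subsets of M and of N are stored as their trace on L together with the
  -- bits that record membership of z, respectively of x and y.
  toM : Subset u → Bool → Subset u
  toM S b = (S ∩ L) ∪ (replicate u b ∩ Z)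

  toN : Subset u → Bool → Bool → Subset u
  toN S b c = (S ∩ L) ∪ ((replicate u b ∩ X) ∪ (replicate u c ∩ Y))

  toMᴱ : ∀ {n} → Expr (4 ℕ+ n) → Expr (4 ℕ+ n) → Expr (4 ℕ+ n)
  toMᴱ e b = (e ⊓ 𝐋) ⊔ (b ⊓ 𝐙)

  toNᴱ : ∀ {n} → Expr (4 ℕ+ n) → Expr (4 ℕ+ n) → Expr (4 ℕ+ n) → Expr (4 ℕ+ n)
  toNᴱ e b c = (e ⊓ 𝐋) ⊔ ((b ⊓ 𝐗) ⊔ (c ⊓ 𝐘))

  toM-∪ : ∀ A B b c → toM (A ∪ B) (b ∨ c) ≡ toM A b ∪ toM B c
  -- Splitting the constant vector of b ∨ c into a union makes each bit a set variable of the
  -- identity.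
  toM-∪ A B b c rewrite ≡.sym (zipWith-replicate {n = u} _∨_ b c) =
    identity [] (toMᴱ (𝐚 ⊔ 𝐛) (𝐜 ⊔ var (# 7)) ≗ toMᴱ 𝐚 𝐜 ⊔ toMᴱ 𝐛 (var (# 7)))
      (A ∷ B ∷ replicate u b ∷ replicate u c ∷ []) []

  toM-∩ : ∀ A B b c → toM (A ∩ B) (b ∧ c) ≡ toM A b ∩ toM B c
  toM-∩ A B b c rewrite ≡.sym (zipWith-replicate {n = u} _∧_ b c) =
    identity [] (toMᴱ (𝐚 ⊓ 𝐛) (𝐜 ⊓ var (# 7)) ≗ toMᴱ 𝐚 𝐜 ⊓ toMᴱ 𝐛 (var (# 7)))
      (A ∷ B ∷ replicate u b ∷ replicate u c ∷ []) []

  toN-∪ : ∀ A B b c b′ c′ → toN (A ∪ B) (b ∨ b′) (c ∨ c′) ≡ toN A b c ∪ toN B b′ c′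
  toN-∪ A B b c b′ c′
    rewrite ≡.sym (zipWith-replicate {n = u} _∨_ b b′) | ≡.sym (zipWith-replicate {n = u} _∨_ c c′) =
    identity [] (toNᴱ (𝐚 ⊔ 𝐛) (𝐜 ⊔ var (# 8)) (var (# 7) ⊔ var (# 9))
                  ≗ toNᴱ 𝐚 𝐜 (var (# 7)) ⊔ toNᴱ 𝐛 (var (# 8)) (var (# 9)))
      (A ∷ B ∷ replicate u b ∷ replicate u c ∷ replicate u b′ ∷ replicate u c′ ∷ []) []

  toN-∩ : ∀ A B b c b′ c′ → toN (A ∩ B) (b ∧ b′) (c ∧ c′) ≡ toN A b c ∩ toN B b′ c′
  toN-∩ A B b c b′ c′
    rewrite ≡.sym (zipWith-replicate {n = u} _∧_ b b′) | ≡.sym (zipWith-replicate {n = u} _∧_ c c′) =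
    identity [] (toNᴱ (𝐚 ⊓ 𝐛) (𝐜 ⊓ var (# 8)) (var (# 7) ⊓ var (# 9))
                  ≗ toNᴱ 𝐚 𝐜 (var (# 7)) ⊓ toNᴱ 𝐛 (var (# 8)) (var (# 9)))
      (A ∷ B ∷ replicate u b ∷ replicate u c ∷ replicate u b′ ∷ replicate u c′ ∷ []) []

  toM-⊆ : ∀ S b → toM S b ⊆ M
  toM-⊆ S b = ≡.subst (toM S b ⊆_) (≡.sym M≡) (∪≡⇒⊆
    (identity [] (toMᴱ 𝐚 𝐛 ⊔ (𝐋 ⊔ 𝐙) ≗ 𝐋 ⊔ 𝐙) (S ∷ replicate u b ∷ []) []))

  toN-⊆ : ∀ S b c → toN S b c ⊆ N
  toN-⊆ S b c = ≡.subst (toN S b c ⊆_) (≡.sym N≡) (∪≡⇒⊆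
    (identity [] (toNᴱ 𝐚 𝐛 𝐜 ⊔ (𝐋 ⊔ (𝐗 ⊔ 𝐘)) ≗ 𝐋 ⊔ (𝐗 ⊔ 𝐘)) (S ∷ replicate u b ∷ replicate u c ∷ []) []))

  toM-toN : ∀ S b c d → toM (toN S b c) d ≡ toM S d
  toM-toN S b c d = identity [] (toMᴱ (toNᴱ 𝐚 𝐛 𝐜) (var (# 7)) ≗ toMᴱ 𝐚 (var (# 7)))
    (S ∷ replicate u b ∷ replicate u c ∷ replicate u d ∷ []) []

  toN-toM : ∀ S b c d → toN (toM S d) b c ≡ toN S b c
  toN-toM S b c d = identity [] (toNᴱ (toMᴱ 𝐚 (var (# 7))) 𝐛 𝐜 ≗ toNᴱ 𝐚 𝐛 𝐜)
    (S ∷ replicate u b ∷ replicate u c ∷ replicate u d ∷ []) []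

  toM-L : toM L false ≡ L
  toM-L = identity [] (toMᴱ 𝐋 (const false) ≗ 𝐋) [] []

  toM-M : toM L true ≡ M
  toM-M = ≡.trans (identity [] (toMᴱ 𝐋 (const true) ≗ 𝐋 ⊔ 𝐙) [] []) (≡.sym M≡)

  toN-N : toN L true true ≡ N
  toN-N = ≡.trans (identity [] (toNᴱ 𝐋 (const true) (const true) ≗ 𝐋 ⊔ (𝐗 ⊔ 𝐘)) [] []) (≡.sym N≡)

  replicate-lookup-∩ : ∀ {n} (i : Fin n) S → replicate n (lookup S i) ∩ ⁅ i ⁆ ≡ S ∩ ⁅ i ⁆
  replicate-lookup-∩ Fin.zero    (a ∷ S) = ≡.cong (a ∧ true ∷_) (≡.trans (∩-zeroʳ _) (≡.sym (∩-zeroʳ _)))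
  replicate-lookup-∩ (Fin.suc i) (a ∷ S) =
    ≡.cong₂ _∷_ (≡.trans (∧-zeroʳ _) (≡.sym (∧-zeroʳ a))) (replicate-lookup-∩ i S)

  toM-normal : ∀ {S} → S ⊆ M → toM S (lookup S z) ≡ S
  toM-normal {S} S⊆M = ≡.trans (≡.cong ((S ∩ L) ∪_) (replicate-lookup-∩ z S))
    (identity ((𝐚 ⊔ (𝐋 ⊔ 𝐙) ≗ 𝐋 ⊔ 𝐙) ∷ []) ((𝐚 ⊓ 𝐋) ⊔ (𝐚 ⊓ 𝐙) ≗ 𝐚) (S ∷ [])
      (⊆⇒∪≡ (≡.subst (S ⊆_) M≡ S⊆M) ∷ []))

  toN-normal : ∀ {S} → S ⊆ N → toN S (lookup S x) (lookup S y) ≡ S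
  toN-normal {S} S⊆N = ≡.trans
    (≡.cong₂ (λ p q → (S ∩ L) ∪ (p ∪ q)) (replicate-lookup-∩ x S) (replicate-lookup-∩ y S))
    (identity ((𝐚 ⊔ (𝐋 ⊔ (𝐗 ⊔ 𝐘)) ≗ 𝐋 ⊔ (𝐗 ⊔ 𝐘)) ∷ []) ((𝐚 ⊓ 𝐋) ⊔ ((𝐚 ⊓ 𝐗) ⊔ (𝐚 ⊓ 𝐘)) ≗ 𝐚) (S ∷ [])
      (⊆⇒∪≡ (≡.subst (S ⊆_) N≡ S⊆N) ∷ []))

  ∩-⁅⁆⇒lookup : ∀ {n} {i : Fin n} {p b} → p ∩ ⁅ i ⁆ ≡ replicate n b ∩ ⁅ i ⁆ → lookup p i ≡ b
  ∩-⁅⁆⇒lookup {n} {i} {p} {b} eq = ≡.trans (≡.sym (at p)) (≡.trans (≡.cong (λ q → lookup q i) eq)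
    (≡.trans (at (replicate n b)) (lookup-replicate i b)))
    where
    at : ∀ q → lookup (q ∩ ⁅ i ⁆) i ≡ lookup q i
    at q = ≡.trans (lookup-zipWith _∧_ i q ⁅ i ⁆)
      (≡.trans (≡.cong (lookup q i ∧_) ([]=⇒lookup (x∈⁅x⁆ i))) (∧-identityʳ _))

  lookup-toM : ∀ S b → lookup (toM S b) z ≡ b
  lookup-toM S b = ∩-⁅⁆⇒lookup {p = toM S b}
    (identity [] (toMᴱ 𝐚 𝐛 ⊓ 𝐙 ≗ 𝐛 ⊓ 𝐙) (S ∷ replicate u b ∷ []) [])

  lookup-toN-x : ∀ S b c → lookup (toN S b c) x ≡ b
  lookup-toN-x S b c = ∩-⁅⁆⇒lookup {p = toN S b c}
    (identity [] (toNᴱ 𝐚 𝐛 𝐜 ⊓ 𝐗 ≗ 𝐛 ⊓ 𝐗) (S ∷ replicate u b ∷ replicate u c ∷ []) [])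

  lookup-toN-y : ∀ S b c → lookup (toN S b c) y ≡ c
  lookup-toN-y S b c = ∩-⁅⁆⇒lookup {p = toN S b c}
    (identity [] (toNᴱ 𝐚 𝐛 𝐜 ⊓ 𝐘 ≗ 𝐜 ⊓ 𝐘) (S ∷ replicate u b ∷ replicate u c ∷ []) [])

  -- Merging x and y into z, and renaming z to x.

  hit : Subset u → Bool
  hit S = lookup S x ∨ lookup S y

  ψ φ : Subset u → Subset u
  ψ S = toM S (hit S)
  φ S = toN S (lookup S z) false

  hit-toN : ∀ S b c → hit (toN S b c) ≡ b ∨ c
  hit-toN S b c = ≡.cong₂ _∨_ (lookup-toN-x S b c) (lookup-toN-y S b c)

  ψ-toN : ∀ S b c → ψ (toN S b c) ≡ toM S (b ∨ c)
  ψ-toN S b c = ≡.trans (toM-toN S b c (hit (toN S b c))) (≡.cong (toM S) (hit-toN S b c))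

  ψ-φ : ∀ {S} → S ⊆ M → ψ (φ S) ≡ S
  ψ-φ {S} S⊆M = ≡.trans (ψ-toN S (lookup S z) false)
    (≡.trans (≡.cong (toM S) (∨-identityʳ _)) (toM-normal S⊆M))

  -- The composite replaces y by x, keeping a single x when both were present.
  φ-ψ : ∀ S → φ (ψ S) ≡ toN S (hit S) false
  φ-ψ S = ≡.trans (toN-toM S (lookup (ψ S) z) false (hit S))
    (≡.cong (λ b → toN S b false) (lookup-toM S (hit S)))

  φ-∪ : ∀ A B → φ (A ∪ B) ≡ φ A ∪ φ B
  φ-∪ A B = ≡.trans (≡.cong (λ b → toN (A ∪ B) b false) (lookup-zipWith _∨_ z A B))
    (toN-∪ A B (lookup A z) false (lookup B z) false)

  φ-∩ : ∀ A B → φ (A ∩ B) ≡ φ A ∩ φ B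
  φ-∩ A B = ≡.trans (≡.cong (λ b → toN (A ∩ B) b false) (lookup-zipWith _∧_ z A B))
    (toN-∩ A B (lookup A z) false (lookup B z) false)

  φ-⊆ : ∀ S → φ S ⊆ N
  φ-⊆ S = toN-⊆ S (lookup S z) false

  ψ-⊆ : ∀ S → ψ S ⊆ M
  ψ-⊆ S = toM-⊆ S (hit S)

  ψ-∪ : ∀ A B → ψ (A ∪ B) ≡ ψ A ∪ ψ B
  ψ-∪ A B = ≡.trans (≡.cong (toM (A ∪ B)) hit-∪) (toM-∪ A B (hit A) (hit B))
    where
    hit-∪ : hit (A ∪ B) ≡ hit A ∨ hit B
    hit-∪ rewrite lookup-zipWith _∨_ x A B | lookup-zipWith _∨_ y A B
      with lookup A x | lookup A y | lookup B x | lookup B y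
    ... | true  | _     | _     | _ = ≡.refl
    ... | false | true  | true  | _ = ≡.refl
    ... | false | true  | false | _ = ≡.refl
    ... | false | false | _     | _ = ≡.refl

  -- ψ fails to preserve an intersection only if one set contains x but not y
  -- and the other contains y but not x.
  ψ-∩ : ∀ A B → ψ (A ∩ B) ≡ ψ A ∩ ψ B
              ⊎ (ψ A ∩ ψ B ≡ toM (A ∩ B) true × ψ (A ∩ B) ≡ toM (A ∩ B) false)
  ψ-∩ A B with hit-∩
    where
    hit-∩ : hit (A ∩ B) ≡ hit A ∧ hit B ⊎ (hit A ∧ hit B ≡ true × hit (A ∩ B) ≡ false)
    hit-∩ rewrite lookup-zipWith _∧_ x A B | lookup-zipWith _∧_ y A B
      with lookup A x | lookup A y | lookup B x | lookup B y
    ... | true  | _     | true  | _     = inj₁ ≡.refl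
    ... | true  | true  | false | true  = inj₁ ≡.refl
    ... | true  | true  | false | false = inj₁ ≡.refl
    ... | true  | false | false | true  = inj₂ (≡.refl , ≡.refl)
    ... | true  | false | false | false = inj₁ ≡.refl
    ... | false | true  | true  | true  = inj₁ ≡.refl
    ... | false | true  | true  | false = inj₂ (≡.refl , ≡.refl)
    ... | false | true  | false | _     = inj₁ ≡.refl
    ... | false | false | _     | _     = inj₁ ≡.refl
  ... | inj₁ eq = inj₁ (≡.trans (≡.cong (toM (A ∩ B)) eq) (toM-∩ A B (hit A) (hit B)))
  ... | inj₂ (both , neither) = inj₂
    ( ≡.trans (≡.sym (toM-∩ A B (hit A) (hit B))) (≡.cong (toM (A ∩ B)) both)
    , ≡.cong (toM (A ∩ B)) neither)

  -- Upper replication as composition with `ψ`.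

  open import Relation.Binary.Reasoning.Setoid setoid

  T : ℝ^𝒫 M → ℝ^𝒫 N
  T = upperReplication N z

  -- What a subset of N has outside L lies in {x,y}, so the test in the definition of the
  -- replication amounts to `hit S`.
  T-! : ∀ r {S} → S ⊆ N → T r ! S ≡ r ! ψ S
  T-! r {S} S⊆N = ≡.trans (!-eval (T r) S⊆N) (by-cases (nonempty? (S ─ L)))
    where
    hit-outside-L : ∀ {i} → i ∈ S ─ L → hit S ≡ true
    hit-outside-L {i} i∈S─L = [ from-x , from-y ]′ (x∈p∪q⁻ X Y i∈X∪Y)
      where
      i∈S : i ∈ S
      i∈S = p─q⊆p S L i∈S─L
      i∈X∪Y : i ∈ X ∪ Y
      i∈X∪Y = ∪≡⇒⊆ {S ─ L} {X ∪ Y}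
        (identity ((𝐚 ⊔ (𝐋 ⊔ (𝐗 ⊔ 𝐘)) ≗ 𝐋 ⊔ (𝐗 ⊔ 𝐘)) ∷ []) ((𝐚 ∖ 𝐋) ⊔ (𝐗 ⊔ 𝐘) ≗ 𝐗 ⊔ 𝐘) (S ∷ [])
          (⊆⇒∪≡ (≡.subst (S ⊆_) N≡ S⊆N) ∷ [])) i∈S─L
      from-x : i ∈ X → hit S ≡ true
      from-x i∈X = ≡.cong (_∨ lookup S y) ([]=⇒lookup (≡.subst (_∈ S) (x∈⁅y⁆⇒x≡y x i∈X) i∈S))
      from-y : i ∈ Y → hit S ≡ true
      from-y i∈Y = ≡.trans (≡.cong (lookup S x ∨_) ([]=⇒lookup (≡.subst (_∈ S) (x∈⁅y⁆⇒x≡y y i∈Y) i∈S)))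
                           (∨-zeroʳ _)

    x∉L : ¬ x ∈ L
    x∉L x∈L = ∉⊥ (≡.subst (x ∈_) (identity [] (𝐋 ⊓ 𝐗 ≗ const false) [] []) (x∈p∩q⁺ (x∈L , x∈⁅x⁆ x)))

    y∉L : ¬ y ∈ L
    y∉L y∈L = ∉⊥ (≡.subst (y ∈_) (identity [] (𝐋 ⊓ 𝐘 ≗ const false) [] []) (x∈p∩q⁺ (y∈L , x∈⁅x⁆ y)))

    not-hit : Empty (S ─ L) → lookup S x ≡ false × lookup S y ≡ false
    not-hit empty = outside x x∉L , outside y y∉L
      where
      outside : ∀ i → ¬ i ∈ L → lookup S i ≡ false
      outside i i∉L with lookup S i in eq
      ... | false = ≡.refl
      ... | true  = ⊥-elim (empty (i , x∈p∧x∉q⇒x∈p─q (lookup⇒[]= i S eq) i∉L))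

    by-cases : (d : Dec (Nonempty (S ─ L))) →
               (if does d then r ! (Z ∪ (S ∩ L)) else r ! S) ≡ r ! ψ S
    by-cases (yes (_ , i∈S─L)) = ≡.cong (r !_) (≡.trans
      (identity [] (𝐙 ⊔ (𝐚 ⊓ 𝐋) ≗ toMᴱ 𝐚 (const true)) (S ∷ []) [])
      (≡.cong (toM S) (≡.sym (hit-outside-L i∈S─L))))
    by-cases (no empty) with not-hit empty
    ... | S∌x , S∌y = ≡.cong (r !_) (≡.trans (≡.sym (toN-normal S⊆N)) (≡.trans
      (≡.cong₂ (toN S) S∌x S∌y) (≡.trans
      (identity [] (toNᴱ 𝐚 (const false) (const false) ≗ toMᴱ 𝐚 (const false)) (S ∷ []) [])
      (≡.cong (toM S) (≡.sym (≡.cong₂ _∨_ S∌x S∌y))))))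

  T-toN : ∀ r S b c → T r ! toN S b c ≡ r ! toM S (b ∨ c)
  T-toN r S b c = ≡.trans (T-! r (toN-⊆ S b c)) (≡.cong (r !_) (ψ-toN S b c))

  T-φ : ∀ r {S} → S ⊆ M → T r ! φ S ≡ r ! S
  T-φ r {S} S⊆M = ≡.trans (T-! r (φ-⊆ S)) (≡.cong (r !_) (ψ-φ S⊆M))

  L⊆M : L ⊆ M
  L⊆M = ≡.subst (_⊆ M) toM-L (toM-⊆ L false)

  Δ-φ : ∀ (f : Subset u → Carrier) A B → Δ (f ∘ φ) A B ≡ Δ f (φ A) (φ B)
  Δ-φ f A B = ≡.cong₂ (λ p q → f p + f q - f (φ A) - f (φ B)) (φ-∪ A B) (φ-∩ A B)

  Δ-T-φ : ∀ r {A B} → A ⊆ M → B ⊆ M → Δ (r !_) A B ≈ Δ (T r !_) (φ A) (φ B)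
  Δ-T-φ r {A} {B} A⊆M B⊆M = trans
    (Δ-cong-⊆ (λ S S⊆M → reflexive (≡.sym (T-φ r S⊆M))) A⊆M B⊆M) (reflexive (Δ-φ (T r !_) A B))

  Δ-T : ∀ r {A B} → A ⊆ N → B ⊆ N →
        Δ (T r !_) A B ≈ r ! (ψ A ∪ ψ B) + r ! ψ (A ∩ B) - r ! ψ A - r ! ψ B
  Δ-T r {A} {B} A⊆N B⊆N = +-cong₄
    (reflexive (≡.trans (T-! r (∪-⊆ {A} {B} A⊆N B⊆N)) (≡.cong (r !_) (ψ-∪ A B))))
    (reflexive (T-! r (∩-⊆ {A} {B} A⊆N))) (reflexive (T-! r A⊆N)) (reflexive (T-! r B⊆N))

  -- Which formula applies depends on A and B alone. The quantifier over r stands inside the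
  -- disjunction so that `T-≅` can use the same formula for two functions.
  Δ-T-cases : ∀ {A B} → A ⊆ N → B ⊆ N →
    (∀ r → Δ (T r !_) A B ≈ Δ (r !_) (ψ A) (ψ B)) ⊎
    (∀ r → Δ (T r !_) A B ≈ Δ (r !_) (ψ A) (ψ B) + (Δ (r !_) (ψ A ∩ ψ B) L + (r ! L - r ! M)))
  Δ-T-cases {A} {B} A⊆N B⊆N with ψ-∩ A B
  ... | inj₁ eq = inj₁ λ r → trans (Δ-T r A⊆N B⊆N)
    (+-cong₄ refl (reflexive (≡.cong (r !_) eq)) refl refl)
  ... | inj₂ (∩≡ , ψ∩≡) = inj₂ λ r → begin
    Δ (T r !_) A B
      ≈⟨ Δ-T r A⊆N B⊆N ⟩
    r ! (ψ A ∪ ψ B) + r ! ψ (A ∩ B) - r ! ψ A - r ! ψ B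
      ≈⟨ solve 7 (λ p q s t v l m → p :+ q :- s :- t
           := (p :+ v :- s :- t) :+ ((m :+ q :- v :- l) :+ (l :- m))) refl
           (r ! (ψ A ∪ ψ B)) (r ! ψ (A ∩ B)) (r ! ψ A) (r ! ψ B) (r ! (ψ A ∩ ψ B)) (r ! L) (r ! M) ⟩
    Δ (r !_) (ψ A) (ψ B) + (r ! M + r ! ψ (A ∩ B) - r ! (ψ A ∩ ψ B) - r ! L + (r ! L - r ! M))
      ≈⟨ +-congˡ (+-congʳ (+-cong₄ (reflexive (≡.cong (r !_) M≡′)) (reflexive (≡.cong (r !_) ψ∩≡′)) refl refl)) ⟩
    Δ (r !_) (ψ A) (ψ B) + (Δ (r !_) (ψ A ∩ ψ B) L + (r ! L - r ! M)) ∎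
    where
    -- In this case ψ A ∩ ψ B is ψ (A ∩ B) with z added: its union with L is M, and its intersection
    -- with L is ψ (A ∩ B).
    M≡′ : M ≡ (ψ A ∩ ψ B) ∪ L
    M≡′ = ≡.trans (≡.sym toM-M) (≡.trans
      (identity [] (toMᴱ 𝐋 (const true) ≗ toMᴱ 𝐚 (const true) ⊔ 𝐋) (A ∩ B ∷ []) [])
      (≡.cong (_∪ L) (≡.sym ∩≡)))
    ψ∩≡′ : ψ (A ∩ B) ≡ (ψ A ∩ ψ B) ∩ L
    ψ∩≡′ = ≡.trans ψ∩≡ (≡.trans
      (identity [] (toMᴱ 𝐚 (const false) ≗ toMᴱ 𝐚 (const true) ⊓ 𝐋) (A ∩ B ∷ []) [])
      (≡.cong (_∩ L) (≡.sym ∩≡)))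

  module _ {r : ℝ^𝒫 M} where

    T-𝒦 : 𝒦 M r → r ! M ≤ r ! L → 𝒦 N (T r)
    T-𝒦 r∈𝒦 rM≤rL = 0≤Δ⇒𝒦 nonneg
      where
      nonneg : ∀ {A B} → A ⊆ N → B ⊆ N → 0# ≤ Δ (T r !_) A B
      nonneg {A} {B} A⊆N B⊆N with Δ-T-cases A⊆N B⊆N
      ... | inj₁ eq = ≤-respʳ-≈ (sym (eq r)) (𝒦⇒0≤Δ r∈𝒦 (ψ-⊆ A) (ψ-⊆ B))
      ... | inj₂ eq = ≤-respʳ-≈ (sym (eq r)) (+-nonneg (𝒦⇒0≤Δ r∈𝒦 (ψ-⊆ A) (ψ-⊆ B))
        (+-nonneg (𝒦⇒0≤Δ r∈𝒦 (∩-⊆ {ψ A} {ψ B} (ψ-⊆ A)) L⊆M) (x≤y⇒0≤y-x rM≤rL)))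

    T-ℒ : ℒ M r → r ! L ≈ r ! M → ℒ N (T r)
    T-ℒ r∈ℒ rL≈rM = Δ≈0⇒ℒ zero-Δ
      where
      zero-Δ : ∀ {A B} → A ⊆ N → B ⊆ N → Δ (T r !_) A B ≈ 0#
      zero-Δ {A} {B} A⊆N B⊆N with Δ-T-cases A⊆N B⊆N
      ... | inj₁ eq = trans (eq r) (ℒ⇒Δ≈0 r∈ℒ (ψ-⊆ A) (ψ-⊆ B))
      ... | inj₂ eq = trans (eq r) (trans (+-cong (ℒ⇒Δ≈0 r∈ℒ (ψ-⊆ A) (ψ-⊆ B))
        (trans (+-cong (ℒ⇒Δ≈0 r∈ℒ (∩-⊆ {ψ A} {ψ B} (ψ-⊆ A)) L⊆M) (x≈y⇒x-y≈0 rL≈rM))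
          (+-identityˡ 0#))) (+-identityˡ 0#))

    T-𝒦⁻¹ : 𝒦 N (T r) → 𝒦 M r
    T-𝒦⁻¹ Tr∈𝒦 = 0≤Δ⇒𝒦 λ {A} {B} A⊆M B⊆M →
      ≤-respʳ-≈ (sym (Δ-T-φ r A⊆M B⊆M)) (𝒦⇒0≤Δ Tr∈𝒦 (φ-⊆ A) (φ-⊆ B))

    T-ℒ⁻¹ : ℒ N (T r) → ℒ M r
    T-ℒ⁻¹ Tr∈ℒ = Δ≈0⇒ℒ λ {A} {B} A⊆M B⊆M →
      trans (Δ-T-φ r A⊆M B⊆M) (ℒ⇒Δ≈0 Tr∈ℒ (φ-⊆ A) (φ-⊆ B))

  Lx Ly : Subset u
  Lx = toN L true false
  Ly = toN L false true

  -- `ψ` sends Lx, Ly and their union N to M, but their intersection to L. This pair is the source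
  -- of the condition on r(L) and r(M).
  Δ-Lx-Ly : ∀ r → Δ (T r !_) Lx Ly ≈ r ! L - r ! M
  Δ-Lx-Ly r = begin
    Δ (T r !_) Lx Ly                   ≈⟨ +-cong₄ (at-M true true ∪≡ ≡.refl) at-L
                                          (at-M true false ≡.refl ≡.refl) (at-M false true ≡.refl ≡.refl) ⟩
    r ! M + r ! L - r ! M - r ! M      ≈⟨ solve 2 (λ l m → m :+ l :- m :- m := l :- m) refl (r ! L) (r ! M) ⟩
    r ! L - r ! M                      ∎
    where
    ∪≡ : Lx ∪ Ly ≡ toN L true true
    ∪≡ = ≡.trans (≡.sym (toN-∪ L L true false false true)) (≡.cong (λ S → toN S true true) (∪-idem L))
    at-M : ∀ {S} b c → S ≡ toN L b c → b ∨ c ≡ true → T r ! S ≈ r ! M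
    at-M b c ≡.refl b∨c = reflexive (≡.trans (T-toN r L b c)
      (≡.cong (r !_) (≡.trans (≡.cong (toM L) b∨c) toM-M)))
    at-L : T r ! (Lx ∩ Ly) ≈ r ! L
    at-L = reflexive (≡.trans (≡.cong (T r !_) (≡.trans (≡.sym (toN-∩ L L true false false true))
        (≡.cong (λ S → toN S false false) (∩-idem L))))
      (≡.trans (T-toN r L false false) (≡.cong (r !_) toM-L)))

  T-𝒦⇒rM≤rL : ∀ {r} → 𝒦 N (T r) → r ! M ≤ r ! L
  T-𝒦⇒rM≤rL {r} Tr∈𝒦 = 0≤y-x⇒x≤y (≤-respʳ-≈ (Δ-Lx-Ly r)
    (𝒦⇒0≤Δ Tr∈𝒦 (toN-⊆ L true false) (toN-⊆ L false true)))

  T-·⊖ : ∀ c r r′ → T (c · r ⊖ r′) ≅ (c · T r ⊖ T r′)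
  T-·⊖ c r r′ = Δ-cong-⊆ λ S S⊆N → begin
    T (c · r ⊖ r′) ! S             ≡⟨ T-! (c · r ⊖ r′) S⊆N ⟩
    (c · r ⊖ r′) ! ψ S             ≈⟨ ·⊖-! c r r′ (ψ S) ⟩
    c * r ! ψ S - r′ ! ψ S         ≡⟨ ≡.cong₂ (λ a b → c * a - b) (T-! r S⊆N) (T-! r′ S⊆N) ⟨
    c * T r ! S - T r′ ! S         ≈⟨ ·⊖-! c (T r) (T r′) S ⟨
    (c · T r ⊖ T r′) ! S           ∎

  -- With both equalities, c r - r′ takes the same value on L and M whatever c is, so that `T-𝒦`
  -- applies to it.
  T-≼ : ∀ {r r′} → r ! L ≈ r ! M → r′ ! L ≈ r′ ! M → r′ ≼ r → T r′ ≼ T r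
  T-≼ {r} {r′} rL≈rM r′L≈r′M (c , cr-r′∈𝒦) = c , ≅-𝒦 {m = T (c · r ⊖ r′)} (T-·⊖ c r r′)
    (T-𝒦 cr-r′∈𝒦 (≤-reflexive (sym (trans (·⊖-! c r r′ L)
      (trans (+-cong (*-congˡ rL≈rM) (-‿cong r′L≈r′M)) (sym (·⊖-! c r r′ M)))))))

  T-≼⁻¹ : ∀ {r r′} → T r′ ≼ T r → r′ ≼ r
  T-≼⁻¹ {r} {r′} (c , cTr-Tr′∈𝒦) = c , T-𝒦⁻¹ (≅-𝒦 {m = c · T r ⊖ T r′} {T (c · r ⊖ r′)}
    (≅-sym {m = T (c · r ⊖ r′)} {c · T r ⊖ T r′} (T-·⊖ c r r′)) cTr-Tr′∈𝒦)

  T-≅ : ∀ {r r′} → r ≅ r′ → r ! L - r ! M ≈ r′ ! L - r′ ! M → T r ≅ T r′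
  T-≅ {r} {r′} r≅r′ eq {A} {B} A⊆N B⊆N with Δ-T-cases A⊆N B⊆N
  ... | inj₁ Δ≈ = trans (Δ≈ r) (trans (r≅r′ (ψ-⊆ A) (ψ-⊆ B)) (sym (Δ≈ r′)))
  ... | inj₂ Δ≈ = trans (Δ≈ r) (trans (+-cong (r≅r′ (ψ-⊆ A) (ψ-⊆ B))
    (+-cong (r≅r′ (∩-⊆ {ψ A} {ψ B} (ψ-⊆ A)) L⊆M) eq)) (sym (Δ≈ r′)))

  -- Adjusting r(L) - r(M) by a modular function.

  weight-z-L : ∀ c → weight z c L ≡ 0#
  weight-z-L c = ≡.cong (if_then c else 0#)
    (≡.trans (≡.cong (λ S → lookup S z) (≡.sym toM-L)) (lookup-toM L false))

  weight-z-M : ∀ c → weight z c M ≡ c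
  weight-z-M c = ≡.cong (if_then c else 0#)
    (≡.trans (≡.cong (λ S → lookup S z) (≡.sym toM-M)) (lookup-toM L true))

  M⊆M : M ⊆ M
  M⊆M i∈M = i∈M

  -- Increases r(L) - r(M) by c within the class of r modulo `ℒ M`.
  tiltedBy : Carrier → ℝ^𝒫 M → ℝ^𝒫 M
  tiltedBy c r = restrict M (λ S → r ! S - weight z c S)

  tilted-≅ : ∀ c r → tiltedBy c r ≅ r
  tilted-≅ c r {A} {B} = Δ-shift {k = weight z (- c)} shift (Δ-weight z (- c) A B)
    where
    negated : ∀ b → - (if b then c else 0#) ≈ (if b then - c else 0#)
    negated true  = refl
    negated false = solve 0 (:- con ℤ.0ℤ := con ℤ.0ℤ) refl
    shift : ∀ S → S ⊆ M → tiltedBy c r ! S ≈ r ! S + weight z (- c) S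
    shift S S⊆M = trans (reflexive (restrict-! _ S⊆M)) (+-congˡ (negated (lookup S z)))

  tilted-L : ∀ c r → tiltedBy c r ! L ≈ r ! L
  tilted-L c r = trans (reflexive (≡.trans (restrict-! _ L⊆M) (≡.cong (λ a → r ! L - a) (weight-z-L c))))
    (solve 1 (λ a → a :- con ℤ.0ℤ := a) refl (r ! L))

  tilted-M : ∀ c r → tiltedBy c r ! M ≈ r ! M - c
  tilted-M c r = reflexive (≡.trans (restrict-! _ M⊆M) (≡.cong (λ a → r ! M - a) (weight-z-M c)))

  -- The elements of the face of an upper replication.

  module _ {r : ℝ^𝒫 M} {m : ℝ^𝒫 N} where
    private
      -- Ly is N without x and Lx is N without y, so these are the increments of m when x,
      -- respectively y, is added last.
      jump-x jump-y : Carrier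
      jump-x = m ! N - m ! Ly
      jump-y = m ! N - m ! Lx

    collapse : ℝ^𝒫 M
    collapse = tiltedBy jump-x (restrict M (λ S → m ! φ S))

    -- For m in the face of T r, adding y to a set that contains x changes m by
    -- a constant, and symmetrically; subtracting both weights from m leaves an
    -- upper replication.
    module _ (m∈F : faceOf (T r) m) where

      private
        -- The two equalities for `T r` make (S, K) a tight pair, so Δ m vanishes on it too. For the
        -- increment of y the pair is D ∪ {x,y} and L ∪ x.
        increment : ∀ {S S′ K} → S ⊆ N → K ⊆ N → S ∪ K ≡ N → S ∩ K ≡ S′ →
                    T r ! N ≈ T r ! K → T r ! S′ ≈ T r ! S → m ! S ≈ m ! S′ + (m ! N - m ! K)
        increment {S} {S′} {K} S⊆N K⊆N ∪≡ ∩≡ N≈K S′≈S = begin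
          m ! S                            ≈⟨ solve 4 (λ n s′ s k → s := s′ :+ (n :- k) :- (n :+ s′ :- s :- k)) refl
                                                (m ! N) (m ! S′) (m ! S) (m ! K) ⟩
          m ! S′ + (m ! N - m ! K) - (m ! N + m ! S′ - m ! S - m ! K)
                                           ≈⟨ +-congˡ (-‿cong Δm≈0) ⟩
          m ! S′ + (m ! N - m ! K) - 0#    ≈⟨ solve 1 (λ a → a :- con ℤ.0ℤ := a) refl _ ⟩
          m ! S′ + (m ! N - m ! K)         ∎
          where
          Δ≡ : ∀ (f : Subset u → Carrier) → Δ f S K ≡ f N + f S′ - f S - f K
          Δ≡ f = ≡.cong₂ (λ p q → f p + f q - f S - f K) ∪≡ ∩≡
          ΔTr≈0 : Δ (T r !_) S K ≈ 0#
          ΔTr≈0 = begin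
            Δ (T r !_) S K                             ≡⟨ Δ≡ (T r !_) ⟩
            T r ! N + T r ! S′ - T r ! S - T r ! K     ≈⟨ +-cong₄ N≈K S′≈S refl refl ⟩
            T r ! K + T r ! S - T r ! S - T r ! K      ≈⟨ solve 2 (λ k s → k :+ s :- s :- k := con ℤ.0ℤ) refl
                                                            (T r ! K) (T r ! S) ⟩
            0#                                         ∎
          Δm≈0 : m ! N + m ! S′ - m ! S - m ! K ≈ 0#
          Δm≈0 = trans (reflexive (≡.sym (Δ≡ (m !_)))) (proj₂ m∈F (S⊆N , K⊆N , ΔTr≈0))

        increment-y : ∀ D → m ! toN D true true ≈ m ! toN D true false + jump-y
        increment-y D = increment (toN-⊆ D true true) (toN-⊆ L true false)
          (≡.trans (≡.sym (toN-∪ D L true true true false))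
            (≡.trans (identity [] (toNᴱ (𝐚 ⊔ 𝐋) 𝐛 𝐛 ≗ toNᴱ 𝐋 𝐛 𝐛) (D ∷ replicate u true ∷ []) []) toN-N))
          (≡.trans (≡.sym (toN-∩ D L true true true false))
            (identity [] (toNᴱ (𝐚 ⊓ 𝐋) 𝐛 𝐜 ≗ toNᴱ 𝐚 𝐛 𝐜) (D ∷ replicate u true ∷ replicate u false ∷ []) []))
          (reflexive (≡.trans (≡.cong (T r !_) (≡.sym toN-N))
            (≡.trans (T-toN r L true true) (≡.sym (T-toN r L true false)))))
          (reflexive (≡.trans (T-toN r D true false) (≡.sym (T-toN r D true true))))

        increment-x : ∀ D → m ! toN D true true ≈ m ! toN D false true + jump-x
        increment-x D = increment (toN-⊆ D true true) (toN-⊆ L false true)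
          (≡.trans (≡.sym (toN-∪ D L true true false true))
            (≡.trans (identity [] (toNᴱ (𝐚 ⊔ 𝐋) 𝐛 𝐛 ≗ toNᴱ 𝐋 𝐛 𝐛) (D ∷ replicate u true ∷ []) []) toN-N))
          (≡.trans (≡.sym (toN-∩ D L true true false true))
            (identity [] (toNᴱ (𝐚 ⊓ 𝐋) 𝐛 𝐜 ≗ toNᴱ 𝐚 𝐛 𝐜) (D ∷ replicate u false ∷ replicate u true ∷ []) []))
          (reflexive (≡.trans (≡.cong (T r !_) (≡.sym toN-N))
            (≡.trans (T-toN r L true true) (≡.sym (T-toN r L false true)))))
          (reflexive (≡.trans (T-toN r D false true) (≡.sym (T-toN r D true true))))

      T-collapse-! : ∀ S → S ⊆ N → m ! S ≈ T collapse ! S + (weight x jump-x S + weight y jump-y S)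
      T-collapse-! S S⊆N = begin
        m ! S
          ≡⟨ ≡.cong (m !_) (toN-normal S⊆N) ⟨
        m ! toN S (lookup S x) (lookup S y)
          ≈⟨ bits (lookup S x) (lookup S y) ⟩
        m ! toN S (hit S) false - (if hit S then jump-x else 0#) + (weight x jump-x S + weight y jump-y S)
          ≡⟨ ≡.cong (_+ (weight x jump-x S + weight y jump-y S)) T-collapse≡ ⟨
        T collapse ! S + (weight x jump-x S + weight y jump-y S) ∎
        where
        T-collapse≡ : T collapse ! S ≡ m ! toN S (hit S) false - (if hit S then jump-x else 0#)
        T-collapse≡ = ≡.trans (T-! collapse S⊆N) (≡.trans (restrict-! _ (ψ-⊆ S))
          (≡.cong₂ (λ a b → a - (if b then jump-x else 0#))
            (≡.trans (restrict-! _ (ψ-⊆ S)) (≡.cong (m !_) (φ-ψ S))) (lookup-toM S (hit S))))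
        bits : ∀ b c → m ! toN S b c ≈ m ! toN S (b ∨ c) false - (if b ∨ c then jump-x else 0#)
                 + ((if b then jump-x else 0#) + (if c then jump-y else 0#))
        bits true  true  = trans (increment-y S)
          (solve 3 (λ a p q → a :+ q := a :- p :+ (p :+ q)) refl _ jump-x jump-y)
        bits true  false = solve 2 (λ a p → a := a :- p :+ (p :+ con ℤ.0ℤ)) refl _ jump-x
        -- A set with y alone is compared with the set having x alone by way of the set having both.
        bits false true  = begin
          m ! toN S false true                          ≈⟨ solve 2 (λ a p → a := a :+ p :- p) refl _ jump-x ⟩
          m ! toN S false true + jump-x - jump-x        ≈⟨ +-congʳ (increment-x S) ⟨
          m ! toN S true true - jump-x                  ≈⟨ +-congʳ (increment-y S) ⟩
          m ! toN S true false + jump-y - jump-x        ≈⟨ solve 3 (λ a p q → a :+ q :- p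
                                                             := a :- p :+ (con ℤ.0ℤ :+ q)) refl _ jump-x jump-y ⟩
          m ! toN S true false - jump-x + (0# + jump-y) ∎
        bits false false = solve 1 (λ a → a := a :- con ℤ.0ℤ :+ (con ℤ.0ℤ :+ con ℤ.0ℤ)) refl _

      collapse-≅ : m ≅ T collapse
      collapse-≅ {A} {B} = Δ-shift T-collapse-! (trans (Δ-+ _ _ A B)
        (trans (+-cong (Δ-weight x jump-x A B) (Δ-weight y jump-y A B)) (+-identityˡ 0#)))

      -- The pair (Lx, Ly) is tight for `T r` when r(L) = r(M), hence Δ m vanishes on it as well.
      collapse-L≈M : r ! L ≈ r ! M → collapse ! L ≈ collapse ! M
      collapse-L≈M rL≈rM = x-y≈0⇒x≈y (begin
        collapse ! L - collapse ! M  ≈⟨ Δ-Lx-Ly collapse ⟨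
        Δ (T collapse !_) Lx Ly      ≈⟨ collapse-≅ (toN-⊆ L true false) (toN-⊆ L false true) ⟨
        Δ (m !_) Lx Ly               ≈⟨ proj₂ m∈F (toN-⊆ L true false , toN-⊆ L false true ,
                                          trans (Δ-Lx-Ly r) (x≈y⇒x-y≈0 rL≈rM)) ⟩
        0#                           ∎)

  -- Transfer of extremality.

  T-extremal : ∀ {r} → r ! L ≈ r ! M → Extremal M r → Extremal N (T r)
  T-extremal {r} rL≈rM (r∈𝒦 , r∉ℒ , dichotomy) =
    T-𝒦 r∈𝒦 (≤-reflexive (sym rL≈rM)) , (λ Tr∈ℒ → r∉ℒ (T-ℒ⁻¹ Tr∈ℒ)) , dichotomy′
    where
    dichotomy′ : ∀ m → 𝒦 N m → m ≼ T r → ℒ N m ⊎ T r ≼ m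
    dichotomy′ m m∈𝒦 m≼Tr =
      [ (λ ρ∈ℒ → inj₁ (≅-ℒ {m = T ρ} {m} Tρ≅m (T-ℒ ρ∈ℒ ρL≈ρM)))
      , (λ r≼ρ → inj₂ (≅-≼ {m = T r} {T r} {T ρ} {m} (λ _ _ → refl) Tρ≅m (T-≼ ρL≈ρM rL≈rM r≼ρ)))
      ]′ (dichotomy ρ (T-𝒦⁻¹ (≅-𝒦 {m = m} {T ρ} m≅Tρ m∈𝒦))
           (T-≼⁻¹ (≅-≼ {m = m} {T ρ} {T r} {T r} m≅Tρ (λ _ _ → refl) m≼Tr)))
      where
      m∈F = ≼⇒faceOf m∈𝒦 m≼Tr
      ρ : ℝ^𝒫 M
      ρ = collapse {r} {m}
      m≅Tρ : m ≅ T ρ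
      m≅Tρ = collapse-≅ {r} {m} m∈F
      Tρ≅m : T ρ ≅ m
      Tρ≅m = ≅-sym {m = m} {T ρ} m≅Tρ
      ρL≈ρM : ρ ! L ≈ ρ ! M
      ρL≈ρM = collapse-L≈M {r} {m} m∈F rL≈rM

  T-extremal⁻¹ : ∀ {r} → r ! L ≈ r ! M → Extremal N (T r) → Extremal M r
  T-extremal⁻¹ {r} rL≈rM (Tr∈𝒦 , Tr∉ℒ , dichotomy) =
    T-𝒦⁻¹ Tr∈𝒦 , (λ r∈ℒ → Tr∉ℒ (T-ℒ r∈ℒ rL≈rM)) , dichotomy′
    where
    dichotomy′ : ∀ r′ → 𝒦 M r′ → r′ ≼ r → ℒ M r′ ⊎ r ≼ r′
    dichotomy′ r′ r′∈𝒦 r′≼r =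
      [ (λ Tρ∈ℒ → inj₁ (≅-ℒ {m = ρ} {r′} ρ≅r′ (T-ℒ⁻¹ Tρ∈ℒ)))
      , (λ Tr≼Tρ → inj₂ (≅-≼ {m = r} {r} {ρ} {r′} (λ _ _ → refl) ρ≅r′ (T-≼⁻¹ Tr≼Tρ)))
      ]′ (dichotomy (T ρ) (T-𝒦 (≅-𝒦 {m = r′} {ρ} r′≅ρ r′∈𝒦) (≤-reflexive (sym ρL≈ρM)))
           (T-≼ rL≈rM ρL≈ρM (≅-≼ {m = r′} {ρ} {r} {r} r′≅ρ (λ _ _ → refl) r′≼r)))
      where
      -- Being below r does not force r′(L) = r′(M), and without a condition there `T r′` may leave
      -- `𝒦 N`. The tilt restores the equality.
      ρ : ℝ^𝒫 M
      ρ = tiltedBy (r′ ! M - r′ ! L) r′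
      ρ≅r′ : ρ ≅ r′
      ρ≅r′ = tilted-≅ _ r′
      r′≅ρ : r′ ≅ ρ
      r′≅ρ = ≅-sym {m = ρ} {r′} ρ≅r′
      ρL≈ρM : ρ ! L ≈ ρ ! M
      ρL≈ρM = trans (tilted-L _ r′) (trans
        (solve 2 (λ l m → l := m :- (m :- l)) refl (r′ ! L) (r′ ! M)) (sym (tilted-M _ r′)))

  -- The case r(L) > r(M).

  zeroᴹ : ℝ^𝒫 M
  zeroᴹ = restrict M (λ _ → 0#)

  zeroᴹ-! : ∀ {S} → S ⊆ M → zeroᴹ ! S ≡ 0#
  zeroᴹ-! = restrict-! _

  -- The replication on the left is 0 on the subsets of L and -c elsewhere: c times the indicator,
  -- lowered by the constant c.
  Δ-subsetIndicator : ∀ c {A B} → A ⊆ N → B ⊆ N →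
                      Δ (T (tiltedBy c zeroᴹ) !_) A B ≈ Δ ((c · subsetIndicator {N} L) !_) A B
  Δ-subsetIndicator c {A} {B} = Δ-shift {k = λ _ → - c} eq (Δ-const (- c) A B)
    where
    eq : ∀ S → S ⊆ N → T (tiltedBy c zeroᴹ) ! S ≈ (c · subsetIndicator {N} L) ! S + - c
    eq S S⊆N = begin
      T (tiltedBy c zeroᴹ) ! S                         ≡⟨ T-! _ S⊆N ⟩
      tiltedBy c zeroᴹ ! ψ S                           ≡⟨ restrict-! _ (ψ-⊆ S) ⟩
      zeroᴹ ! ψ S - weight z c (ψ S)                   ≡⟨ ≡.cong₂ (λ a b → a - (if b then c else 0#))
                                                            (zeroᴹ-! (ψ-⊆ S)) (lookup-toM S (hit S)) ⟩
      0# - (if hit S then c else 0#)                   ≈⟨ by-hit (S ⊆? L) (hit S) ≡.refl ⟩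
      c * (if does (S ⊆? L) then 1# else 0#) - c       ≡⟨ ≡.cong (λ a → a - c)
                                                            (!-eval (c · subsetIndicator {N} L) S⊆N) ⟨
      (c · subsetIndicator {N} L) ! S - c              ∎
      where
      by-hit : (d : Dec (S ⊆ L)) → ∀ b → hit S ≡ b →
               0# - (if b then c else 0#) ≈ c * (if does d then 1# else 0#) - c
      by-hit (yes _) false _ = solve 1 (λ c → con ℤ.0ℤ :- con ℤ.0ℤ := c :- c) refl c
        ⟨ trans ⟩ +-congʳ (sym (*-identityʳ c))
      by-hit (no _) true _ = +-congʳ (sym (zeroʳ c))
      by-hit (yes S⊆L) true eq = ⊥-elim (false≢true (≡.trans (≡.sym unhit) eq))
        where
        false≢true : false ≢ true
        false≢true ()
        S≡ : S ≡ toN S false false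
        S≡ = identity ((𝐚 ⊔ 𝐋 ≗ 𝐋) ∷ []) (𝐚 ≗ toNᴱ 𝐚 (const false) (const false)) (S ∷ []) (⊆⇒∪≡ S⊆L ∷ [])
        unhit : hit S ≡ false
        unhit = ≡.trans (≡.cong hit S≡) (hit-toN S false false)
      by-hit (no S⊈L) false eq = ⊥-elim (S⊈L (∪≡⇒⊆ {S} {L} (≡.trans (≡.cong (_∪ L) S≡)
        (identity [] (toNᴱ 𝐚 (const false) (const false) ⊔ 𝐋 ≗ 𝐋) (S ∷ []) []))))
        where
        S≡ : S ≡ toN S false false
        S≡ = ≡.trans (≡.sym (toN-normal S⊆N)) (≡.cong₂ (toN S) (∨-conicalˡ _ _ eq) (∨-conicalʳ _ _ eq))

  -- With ω(S) = -(r(L) - r(M))·[z ∈ S], the function r - ω takes the same value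
  -- on L and M, so T (r - ω) is supermodular; hence T ω ≼ T r.
  T-extremal-steep : ∀ {r} → Extremal N (T r) → ¬ (r ! L ≈ r ! M) →
                     ℒ M r × T r ≋ (r ! L - r ! M) · subsetIndicator L
  T-extremal-steep {r} (Tr∈𝒦 , _ , dichotomy) rL≉rM =
    r∈ℒ , ≅⇒≋ {m = T r} {δ · subsetIndicator L} λ A⊆N B⊆N →
      trans (Tr≅Tω A⊆N B⊆N) (Δ-subsetIndicator δ A⊆N B⊆N)
    where
    δ : Carrier
    δ = r ! L - r ! M
    ω : ℝ^𝒫 M
    ω = tiltedBy δ zeroᴹ
    ω-jump : ω ! L - ω ! M ≈ δ
    ω-jump = trans (+-cong (trans (tilted-L δ zeroᴹ) (reflexive (zeroᴹ-! L⊆M)))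
        (-‿cong (trans (tilted-M δ zeroᴹ) (+-congʳ (reflexive (zeroᴹ-! M⊆M))))))
      (solve 1 (λ d → con ℤ.0ℤ :- (con ℤ.0ℤ :- d) := d) refl δ)
    Δω≈0 : ∀ {A B} → A ⊆ M → B ⊆ M → Δ (ω !_) A B ≈ 0#
    Δω≈0 {A} {B} A⊆M B⊆M = trans (tilted-≅ δ zeroᴹ A⊆M B⊆M)
      (trans (Δ-cong-⊆ (λ S S⊆M → reflexive (zeroᴹ-! S⊆M)) A⊆M B⊆M) (Δ-const 0# A B))
    ω∈ℒ : ℒ M ω
    ω∈ℒ = Δ≈0⇒ℒ Δω≈0
    Tω∉ℒ : ¬ ℒ N (T ω)
    Tω∉ℒ Tω∈ℒ = rL≉rM (x-y≈0⇒x≈y (trans (sym ω-jump) (trans (sym (Δ-Lx-Ly ω))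
      (ℒ⇒Δ≈0 Tω∈ℒ (toN-⊆ L true false) (toN-⊆ L false true)))))
    Tω∈𝒦 : 𝒦 N (T ω)
    Tω∈𝒦 = T-𝒦 (ℒ⇒𝒦 ω∈ℒ) (0≤y-x⇒x≤y (≤-respʳ-≈ (sym ω-jump) (x≤y⇒0≤y-x (T-𝒦⇒rM≤rL Tr∈𝒦))))
    r-ω : ℝ^𝒫 M
    r-ω = 1# · r ⊖ ω
    Δ-r-ω : r-ω ≅ r
    Δ-r-ω {A} {B} A⊆M B⊆M = trans (Δ-·⊖ 1# r ω A B) (trans
      (+-cong (*-identityˡ _) (-‿cong (Δω≈0 A⊆M B⊆M))) (solve 1 (λ a → a :- con ℤ.0ℤ := a) refl _))
    r-ω-jump : r-ω ! L ≈ r-ω ! M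
    r-ω-jump = x-y≈0⇒x≈y (begin
      r-ω ! L - r-ω ! M
        ≈⟨ +-cong (·⊖-! 1# r ω L) (-‿cong (·⊖-! 1# r ω M)) ⟩
      1# * r ! L - ω ! L - (1# * r ! M - ω ! M)
        ≈⟨ +-cong (+-congʳ (*-identityˡ _)) (-‿cong (+-congʳ (*-identityˡ _))) ⟩
      r ! L - ω ! L - (r ! M - ω ! M)
        ≈⟨ solve 4 (λ a b c d → a :- b :- (c :- d) := a :- c :- (b :- d)) refl _ _ _ _ ⟩
      r ! L - r ! M - (ω ! L - ω ! M)
        ≈⟨ x≈y⇒x-y≈0 (sym ω-jump) ⟩
      0# ∎)
    Tω≼Tr : T ω ≼ T r
    Tω≼Tr = 1# , ≅-𝒦 {m = T r-ω} (T-·⊖ 1# r ω)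
      (T-𝒦 (≅-𝒦 {m = r} {r-ω} (≅-sym {m = r-ω} {r} Δ-r-ω) (T-𝒦⁻¹ Tr∈𝒦)) (≤-reflexive (sym r-ω-jump)))
    r≼ω : r ≼ ω
    r≼ω = [ (λ Tω∈ℒ → ⊥-elim (Tω∉ℒ Tω∈ℒ)) , T-≼⁻¹ ]′ (dichotomy (T ω) Tω∈𝒦 Tω≼Tr)
    -- Every pair is tight for the modular ω, so r ≼ ω makes all Δ r vanish. Then r and ω are
    -- modular with the same difference between L and M, and their replications agree modulo `ℒ N`.
    r∈ℒ : ℒ M r
    r∈ℒ = Δ≈0⇒ℒ λ {A} {B} A⊆M B⊆M → proj₂ (≼⇒faceOf (T-𝒦⁻¹ Tr∈𝒦) r≼ω) (A⊆M , B⊆M , Δω≈0 A⊆M B⊆M)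
    Tr≅Tω : T r ≅ T ω
    Tr≅Tω = T-≅ (λ A⊆M B⊆M → trans (ℒ⇒Δ≈0 r∈ℒ A⊆M B⊆M) (sym (Δω≈0 A⊆M B⊆M))) (sym ω-jump)

  -- Upper standardization.

  open import Algebra.Properties.Monoid.Sum +-monoid using (sum-cong-≋)

  -- The correction is a constant plus a sum of weights.
  upperStandardization-≅ : ∀ r → upperStandardization r ≅ r
  upperStandardization-≅ r {A} {B} = Δ-shift shift
    (trans (Δ-+ (λ _ → k) (λ S → sumElements S slope) A B)
      (trans (+-cong (Δ-const k A B) (Δ-sumElements slope A B)) (+-identityˡ 0#)))
    where
    k : Carrier
    k = (fromℕ ∣ M ∣ - 1#) * r ! M - Σ[ j ∈ M ] (r ! (M ─ ⁅ j ⁆))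
    slope : Fin u → Carrier
    slope i = r ! (M ─ ⁅ i ⁆) - r ! M
    shift : ∀ S → S ⊆ M → upperStandardization r ! S ≈ r ! S + (k + sumElements S slope)
    shift S S⊆M = begin
      upperStandardization r ! S
        ≡⟨ !-eval (upperStandardization r) S⊆M ⟩
      r (S , [ S⊆M ]) + (fromℕ ∣ M ∣ - 1#) * r ! M - Σ[ j ∈ M ] (r ! (M ─ ⁅ j ⁆)) + sumElements S slope
        ≡⟨ ≡.cong (λ a → a + (fromℕ ∣ M ∣ - 1#) * r ! M - Σ[ j ∈ M ] (r ! (M ─ ⁅ j ⁆)) + sumElements S slope)
                  (!-eval r S⊆M) ⟨
      r ! S + (fromℕ ∣ M ∣ - 1#) * r ! M - Σ[ j ∈ M ] (r ! (M ─ ⁅ j ⁆)) + sumElements S slope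
        ≈⟨ solve 4 (λ a b c d → a :+ b :- c :+ d := a :+ (b :- c :+ d)) refl _ _ _ _ ⟩
      r ! S + (k + sumElements S slope) ∎

  -- The sums over L and M differ only by the term of z, which is r(L) - r(M) = 0.
  upperStandardization-L≈M : ∀ r → r ! L ≈ r ! M → upperStandardization r ! L ≈ upperStandardization r ! M
  upperStandardization-L≈M r rL≈rM = begin
    upperStandardization r ! L  ≡⟨ !-eval (upperStandardization r) L⊆M ⟩
    upperStandardization r (L , [ L⊆M ])
      ≈⟨ +-cong (+-congʳ (+-congʳ (trans (reflexive (≡.sym (!-eval r L⊆M)))
                  (trans rL≈rM (reflexive (!-eval r M⊆M)))))) (sum-cong-≋ same-term) ⟩
    upperStandardization r (M , [ M⊆M ])  ≡⟨ !-eval (upperStandardization r) M⊆M ⟨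
    upperStandardization r ! M  ∎
    where
    same-term : ∀ i → (if does (i ∈? L) then r ! (M ─ ⁅ i ⁆) - r ! M else 0#) ≈
                      (if does (i ∈? M) then r ! (M ─ ⁅ i ⁆) - r ! M else 0#)
    same-term i with i ∈? L | i ∈? M
    ... | yes _   | yes _   = refl
    ... | no _    | no _    = refl
    ... | yes i∈L | no i∉M  = ⊥-elim (i∉M (L⊆M i∈L))
    ... | no i∉L  | yes i∈M with i Fin.≟ z
    ...   | yes ≡.refl = sym (x≈y⇒x-y≈0 rL≈rM)
    ...   | no i≢z     = ⊥-elim (i∉L (x∈p∧x≢y⇒x∈p-y i∈M i≢z))

  T-upperStandardization : ∀ r → r ! L ≈ r ! M → T r ≋ T (upperStandardization r)
  T-upperStandardization r rL≈rM = ≅⇒≋ {m = T r} {T (upperStandardization r)}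
    (T-≅ (≅-sym {m = upperStandardization r} {r} (upperStandardization-≅ r))
      (trans (x≈y⇒x-y≈0 rL≈rM) (sym (x≈y⇒x-y≈0 (upperStandardization-L≈M r rL≈rM)))))

  𝒦ᵤ⇒L≈M : ∀ {r} → 𝒦ᵤ M r → r ! L ≈ r ! M
  𝒦ᵤ⇒L≈M (_ , rM≈0 , r∖≈0) = trans (r∖≈0 z z∈M) (sym rM≈0)

  N-cases : ∀ {i} → i ∈ N → i ∈ L ⊎ i ∈ X ∪ Y
  N-cases {i} i∈N = x∈p∪q⁻ L (X ∪ Y) (≡.subst (i ∈_) N≡ i∈N)

  -- `ψ` sends N, N without x and N without y to M, and for i in L it sends N without i to M without
  -- i.
  T-𝒦ᵤ : ∀ {r} → 𝒦ᵤ M r → 𝒦ᵤ N (T r)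
  T-𝒦ᵤ {r} r∈𝒦ᵤ@(r∈𝒦 , rM≈0 , r∖≈0) =
    T-𝒦 r∈𝒦 (≤-reflexive (sym (𝒦ᵤ⇒L≈M {r} r∈𝒦ᵤ))) , at {b = true} {true} ≡.refl (≡.sym toN-N) ,
    λ i i∈N → [ without-L i , (λ i∈xy → [ without-x i , without-y i ]′ (x∈p∪q⁻ X Y i∈xy)) ]′ (N-cases i∈N)
    where
    at : ∀ {S b c} → b ∨ c ≡ true → S ≡ toN L b c → T r ! S ≈ 0#
    at {b = b} {c} b∨c ≡.refl = trans (reflexive (≡.trans (T-toN r L b c)
      (≡.cong (r !_) (≡.trans (≡.cong (toM L) b∨c) toM-M)))) rM≈0
    without-L : ∀ i → i ∈ L → T r ! (N ─ ⁅ i ⁆) ≈ 0#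
    without-L i i∈L = trans
      (reflexive (≡.trans (≡.cong (T r !_) N─i≡) (≡.trans (T-toN r (L ─ ⁅ i ⁆) true true) (≡.cong (r !_) toM≡))))
      (r∖≈0 i (L⊆M i∈L))
      where
      N─i≡ : N ─ ⁅ i ⁆ ≡ toN (L ─ ⁅ i ⁆) true true
      N─i≡ = ≡.trans (≡.cong (_─ ⁅ i ⁆) N≡)
        (identity ((𝐚 ⊔ 𝐋 ≗ 𝐋) ∷ []) ((𝐋 ⊔ (𝐗 ⊔ 𝐘)) ∖ 𝐚 ≗ toNᴱ (𝐋 ∖ 𝐚) (const true) (const true)) (⁅ i ⁆ ∷ [])
          (⊆⇒∪≡ (⁅⁆-⊆ i∈L) ∷ []))
      toM≡ : toM (L ─ ⁅ i ⁆) true ≡ M ─ ⁅ i ⁆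
      toM≡ = ≡.trans
        (identity ((𝐚 ⊔ 𝐋 ≗ 𝐋) ∷ []) (toMᴱ (𝐋 ∖ 𝐚) (const true) ≗ (𝐋 ⊔ 𝐙) ∖ 𝐚) (⁅ i ⁆ ∷ [])
          (⊆⇒∪≡ (⁅⁆-⊆ i∈L) ∷ []))
        (≡.cong (_─ ⁅ i ⁆) (≡.sym M≡))
    without-x : ∀ i → i ∈ X → T r ! (N ─ ⁅ i ⁆) ≈ 0#
    without-x i i∈X rewrite x∈⁅y⁆⇒x≡y x i∈X = at {b = false} {true} ≡.refl (≡.trans (≡.cong (_─ X) N≡)
      (identity [] ((𝐋 ⊔ (𝐗 ⊔ 𝐘)) ∖ 𝐗 ≗ toNᴱ 𝐋 (const false) (const true)) [] []))
    without-y : ∀ i → i ∈ Y → T r ! (N ─ ⁅ i ⁆) ≈ 0#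
    without-y i i∈Y rewrite x∈⁅y⁆⇒x≡y y i∈Y = at {b = true} {false} ≡.refl (≡.trans (≡.cong (_─ Y) N≡)
      (identity [] ((𝐋 ⊔ (𝐗 ⊔ 𝐘)) ∖ 𝐘 ≗ toNᴱ 𝐋 (const true) (const false)) [] []))

  -- The induced independency model.

  infixr 0 _∘-⇔_
  _∘-⇔_ : ∀ {P Q R : Set} → Q ⇔ R → P ⇔ Q → P ⇔ R
  g ∘-⇔ f = ⇔-trans f g

  ≈0-cong : ∀ {a b} → a ≈ b → (a ≈ 0#) ⇔ (b ≈ 0#)
  ≈0-cong a≈b = mk⇔ (trans (sym a≈b)) (trans a≈b)

  ⊥-cong : ∀ {r : ℝ^𝒫 M} {A B C A′ B′ C′} → A ∪ B ∪ C ≡ A′ ∪ B′ ∪ C′ → C ≡ C′ → A ∪ C ≡ A′ ∪ C′ →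
           B ∪ C ≡ B′ ∪ C′ → A ⊥ B ∥ C [ r ] ⇔ A′ ⊥ B′ ∥ C′ [ r ]
  ⊥-cong {r} p q s t = ≈0-cong (reflexive (≡.cong₂ (λ a b → a - b)
    (≡.cong₂ (λ a b → a - b) (≡.cong₂ (λ a b → r ! a + r ! b) p q) (≡.cong (r !_) s)) (≡.cong (r !_) t)))

  ⊥-sym : ∀ {r : ℝ^𝒫 M} A B C → A ⊥ B ∥ C [ r ] ⇔ B ⊥ A ∥ C [ r ]
  ⊥-sym {r} A B C = ≈0-cong (trans
    (+-congʳ (+-congʳ (+-congʳ (reflexive (≡.cong (r !_)
      (identity [] (𝐚 ⊔ 𝐛 ⊔ 𝐜 ≗ 𝐛 ⊔ 𝐚 ⊔ 𝐜) (A ∷ B ∷ C ∷ []) []))))))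
    (solve 4 (λ p q s t → p :+ q :- s :- t := p :+ q :- t :- s) refl _ _ _ _))

  -- All four sets in the statement are unions of A, B and C, and `ψ` preserves unions.
  T-⊥ : ∀ r {A B C} → A ⊆ N → B ⊆ N → C ⊆ N → A ⊥ B ∥ C [ T r ] ⇔ ψ A ⊥ ψ B ∥ ψ C [ r ]
  T-⊥ r {A} {B} {C} A⊆N B⊆N C⊆N = ≈0-cong (reflexive
    (≡.cong₂ (λ a b → a - b) (≡.cong₂ (λ a b → a - b) (≡.cong₂ (λ a b → a + b)
        (≡.trans (T-! r (∪-⊆ {A} {B ∪ C} A⊆N (∪-⊆ {B} {C} B⊆N C⊆N)))
          (≡.cong (r !_) (≡.trans (ψ-∪ A (B ∪ C)) (≡.cong (ψ A ∪_) (ψ-∪ B C)))))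
        (T-! r C⊆N))
      (≡.trans (T-! r (∪-⊆ {A} {C} A⊆N C⊆N)) (≡.cong (r !_) (ψ-∪ A C))))
      (≡.trans (T-! r (∪-⊆ {B} {C} B⊆N C⊆N)) (≡.cong (r !_) (ψ-∪ B C)))))

  ψ-⊆L : ∀ {S} → S ⊆ L → ψ S ≡ S
  ψ-⊆L {S} S⊆L = ≡.trans (≡.cong ψ S≡) (≡.trans (ψ-toN S false false)
    (identity ((𝐚 ⊔ 𝐋 ≗ 𝐋) ∷ []) (toMᴱ 𝐚 (const false) ≗ 𝐚) (S ∷ []) (⊆⇒∪≡ S⊆L ∷ [])))
    where
    S≡ : S ≡ toN S false false
    S≡ = identity ((𝐚 ⊔ 𝐋 ≗ 𝐋) ∷ []) (𝐚 ≗ toNᴱ 𝐚 (const false) (const false)) (S ∷ []) (⊆⇒∪≡ S⊆L ∷ [])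

  ψ-⁅xy⁆ : ∀ {i} → i ∈ X ∪ Y → ψ ⁅ i ⁆ ≡ Z
  ψ-⁅xy⁆ {i} i∈xy = [ at-x , at-y ]′ (x∈p∪q⁻ X Y i∈xy)
    where
    at-x : i ∈ X → ψ ⁅ i ⁆ ≡ Z
    at-x i∈X rewrite x∈⁅y⁆⇒x≡y x i∈X = ≡.trans
      (≡.cong ψ (identity [] (𝐗 ≗ toNᴱ 𝐗 (const true) (const false)) [] []))
      (≡.trans (ψ-toN X true false) (identity [] (toMᴱ 𝐗 (const true) ≗ 𝐙) [] []))
    at-y : i ∈ Y → ψ ⁅ i ⁆ ≡ Z
    at-y i∈Y rewrite x∈⁅y⁆⇒x≡y y i∈Y = ≡.trans
      (≡.cong ψ (identity [] (𝐘 ≗ toNᴱ 𝐘 (const false) (const true)) [] []))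
      (≡.trans (ψ-toN Y false true) (identity [] (toMᴱ 𝐘 (const true) ≗ 𝐙) [] []))

  hit-Nonempty : ∀ {S} → Nonempty ((X ∪ Y) ∩ S) → hit S ≡ true
  hit-Nonempty {S} (i , i∈) with x∈p∩q⁻ (X ∪ Y) S i∈
  ... | i∈xy , i∈S with x∈p∪q⁻ X Y i∈xy
  ...   | inj₁ i∈X = ≡.cong (_∨ lookup S y) ([]=⇒lookup (≡.subst (_∈ S) (x∈⁅y⁆⇒x≡y x i∈X) i∈S))
  ...   | inj₂ i∈Y = ≡.trans
    (≡.cong (lookup S x ∨_) ([]=⇒lookup (≡.subst (_∈ S) (x∈⁅y⁆⇒x≡y y i∈Y) i∈S))) (∨-zeroʳ _)

  ∣p∣≡1⇒unique : ∀ {p : Subset u} {i j} → ∣ p ∣ ≡ 1 → i ∈ p → j ∈ p → i ≡ j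
  ∣p∣≡1⇒unique {p} {i} {j} ∣p∣≡1 i∈p j∈p with j Fin.≟ i
  ... | yes j≡i = ≡.sym j≡i
  -- Removing i and then j would lower a cardinality of 1 twice.
  ... | no j≢i  = ⊥-elim (n≮0 (≤-pred (<-≤-trans
    (s≤s (x∈p⇒∣p-x∣<∣p∣ (x∈p∧x≢y⇒x∈p-y j∈p j≢i)))
    (≡.subst (∣ p ─ ⁅ i ⁆ ∣ ℕ<_) ∣p∣≡1 (x∈p⇒∣p-x∣<∣p∣ i∈p)))))

  module Independence (r : ℝ^𝒫 M) {a b : Fin u} {C : Subset u} (abC∈ℰ : ℰ N a b C) where
    private
      a∈N = proj₁ abC∈ℰ
      b∈N = proj₁ (proj₂ abC∈ℰ)
      a≢b = proj₁ (proj₂ (proj₂ abC∈ℰ))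

      A B : Subset u
      A = ⁅ a ⁆
      B = ⁅ b ⁆

      C⊆N─ab : C ⊆ N ─ (A ∪ B)
      C⊆N─ab = proj₂ (proj₂ (proj₂ abC∈ℰ))

      C⊆N : C ⊆ N
      C⊆N i∈C = p─q⊆p N (A ∪ B) (C⊆N─ab i∈C)

      avoids : Empty ((X ∪ Y) ∩ C) → C ⊆ L
      avoids xy∩C = ∪≡⇒⊆ (identity
        ((𝐚 ⊔ (𝐋 ⊔ (𝐗 ⊔ 𝐘)) ≗ 𝐋 ⊔ (𝐗 ⊔ 𝐘)) ∷ ((𝐗 ⊔ 𝐘) ⊓ 𝐚 ≗ const false) ∷ []) (𝐚 ⊔ 𝐋 ≗ 𝐋) (C ∷ [])
        (⊆⇒∪≡ (≡.subst (C ⊆_) N≡ C⊆N) ∷ Empty-unique xy∩C ∷ []))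

      reduce : A ⊥ B ∥ C [ T r ] ⇔ ψ A ⊥ ψ B ∥ ψ C [ r ]
      reduce = T-⊥ r (⁅⁆-⊆ a∈N) (⁅⁆-⊆ b∈N) C⊆N

      reduce-to : ∀ {A′ B′ C′} → ψ A ≡ A′ → ψ B ≡ B′ → ψ C ≡ C′ →
                  A ⊥ B ∥ C [ T r ] ⇔ A′ ⊥ B′ ∥ C′ [ r ]
      reduce-to ≡.refl ≡.refl ≡.refl = reduce

    -- Since ψ C contains z, it absorbs the z that ψ A or ψ B may contain; only their traces on L
    -- matter.
    meeting-xy : Nonempty ((X ∪ Y) ∩ C) →
                 A ⊥ B ∥ C [ T r ] ⇔ (A ∩ L) ⊥ (B ∩ L) ∥ (Z ∪ (C ∩ L)) [ r ]
    meeting-xy xy∩C = ⊥-cong {r}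
      (identity [] (toMᴱ 𝐚 (var (# 7)) ⊔ toMᴱ 𝐛 (var (# 8)) ⊔ toMᴱ 𝐜 (const true) ≗
                    (𝐚 ⊓ 𝐋) ⊔ (𝐛 ⊓ 𝐋) ⊔ (𝐙 ⊔ (𝐜 ⊓ 𝐋)))
        (A ∷ B ∷ C ∷ replicate u (hit A) ∷ replicate u (hit B) ∷ []) [])
      (identity [] (toMᴱ 𝐚 (const true) ≗ 𝐙 ⊔ (𝐚 ⊓ 𝐋)) (C ∷ []) [])
      (absorb A) (absorb B)
      ∘-⇔ reduce-to ≡.refl ≡.refl (≡.cong (toM C) (hit-Nonempty xy∩C))
      where
      absorb : ∀ S → ψ S ∪ toM C true ≡ (S ∩ L) ∪ (Z ∪ (C ∩ L))
      absorb S = identity [] (toMᴱ 𝐚 𝐜 ⊔ toMᴱ 𝐛 (const true) ≗ (𝐚 ⊓ 𝐋) ⊔ (𝐙 ⊔ (𝐛 ⊓ 𝐋)))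
        (S ∷ C ∷ replicate u (hit S) ∷ []) []

    inside-L : A ∪ B ∪ C ⊆ L → A ⊥ B ∥ C [ T r ] ⇔ A ⊥ B ∥ C [ r ]
    inside-L ABC⊆L = reduce-to
      (ψ-⊆L λ i∈A → ABC⊆L (x∈p∪q⁺ (inj₁ i∈A)))
      (ψ-⊆L λ i∈B → ABC⊆L (x∈p∪q⁺ (inj₂ (x∈p∪q⁺ (inj₁ i∈B)))))
      (ψ-⊆L λ i∈C → ABC⊆L (x∈p∪q⁺ (inj₂ (x∈p∪q⁺ (inj₂ i∈C)))))

    -- One of a, b merges into z and the other is all that A ∪ B has in L; symmetry of the relation
    -- settles the order.
    one-of-xy : ∣ (X ∪ Y) ∩ (A ∪ B) ∣ ≡ 1 → Empty ((X ∪ Y) ∩ C) →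
                A ⊥ B ∥ C [ T r ] ⇔ Z ⊥ ((A ∪ B) ∩ L) ∥ C [ r ]
    one-of-xy ∣∩∣≡1 xy∩C with N-cases a∈N | N-cases b∈N
    ... | inj₁ a∈L  | inj₁ b∈L  = ⊥-elim (0≢1 (≡.trans (≡.sym (∣⊥∣≡0 u)) (≡.trans (≡.cong ∣_∣ (≡.sym ∩≡⊥)) ∣∩∣≡1)))
      where
      0≢1 : 0 ≢ 1
      0≢1 ()
      ∩≡⊥ : (X ∪ Y) ∩ (A ∪ B) ≡ ⊥
      ∩≡⊥ = identity ((𝐚 ⊔ 𝐋 ≗ 𝐋) ∷ (𝐛 ⊔ 𝐋 ≗ 𝐋) ∷ []) ((𝐗 ⊔ 𝐘) ⊓ (𝐚 ⊔ 𝐛) ≗ const false) (A ∷ B ∷ [])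
        (⊆⇒∪≡ (⁅⁆-⊆ a∈L) ∷ ⊆⇒∪≡ (⁅⁆-⊆ b∈L) ∷ [])
    ... | inj₂ a∈xy | inj₂ b∈xy = ⊥-elim (a≢b (∣p∣≡1⇒unique ∣∩∣≡1
      (x∈p∩q⁺ (a∈xy , x∈p∪q⁺ (inj₁ (x∈⁅x⁆ a)))) (x∈p∩q⁺ (b∈xy , x∈p∪q⁺ (inj₂ (x∈⁅x⁆ b))))))
    ... | inj₂ a∈xy | inj₁ b∈L  = reduce-to (ψ-⁅xy⁆ a∈xy) (≡.trans (ψ-⊆L (⁅⁆-⊆ b∈L)) B≡) (ψ-⊆L (avoids xy∩C))
      where
      B≡ : B ≡ (A ∪ B) ∩ L
      B≡ = identity ((𝐚 ⊔ (𝐗 ⊔ 𝐘) ≗ 𝐗 ⊔ 𝐘) ∷ (𝐛 ⊔ 𝐋 ≗ 𝐋) ∷ []) (𝐛 ≗ (𝐚 ⊔ 𝐛) ⊓ 𝐋) (A ∷ B ∷ [])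
        (⊆⇒∪≡ (⁅⁆-⊆ a∈xy) ∷ ⊆⇒∪≡ (⁅⁆-⊆ b∈L) ∷ [])
    ... | inj₁ a∈L  | inj₂ b∈xy =
      ⊥-sym {r} ((A ∪ B) ∩ L) Z C ∘-⇔ reduce-to (≡.trans (ψ-⊆L (⁅⁆-⊆ a∈L)) A≡) (ψ-⁅xy⁆ b∈xy) (ψ-⊆L (avoids xy∩C))
      where
      A≡ : A ≡ (A ∪ B) ∩ L
      A≡ = identity ((𝐚 ⊔ 𝐋 ≗ 𝐋) ∷ (𝐛 ⊔ (𝐗 ⊔ 𝐘) ≗ 𝐗 ⊔ 𝐘) ∷ []) (𝐚 ≗ (𝐚 ⊔ 𝐛) ⊓ 𝐋) (A ∷ B ∷ [])
        (⊆⇒∪≡ (⁅⁆-⊆ a∈L) ∷ ⊆⇒∪≡ (⁅⁆-⊆ b∈xy) ∷ [])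

    -- Both elements merge into z, and the expression for `Z ⊥ Z ∥ C` cancels down to r(C) - r(z ∪
    -- C).
    both-xy : X ∪ Y ≡ A ∪ B → A ⊥ B ∥ C [ T r ] ⇔ r ! (Z ∪ C) ≈ r ! C
    both-xy xy≡AB = ZZC⇔ ∘-⇔ reduce-to
      (ψ-⁅xy⁆ (≡.subst (a ∈_) (≡.sym xy≡AB) (x∈p∪q⁺ (inj₁ (x∈⁅x⁆ a)))))
      (ψ-⁅xy⁆ (≡.subst (b ∈_) (≡.sym xy≡AB) (x∈p∪q⁺ (inj₂ (x∈⁅x⁆ b)))))
      (ψ-⊆L C⊆L)
      where
      C⊆L : C ⊆ L
      C⊆L = ∪≡⇒⊆ (identity
        ((𝐚 ⊔ ((𝐋 ⊔ (𝐗 ⊔ 𝐘)) ∖ 𝐛) ≗ (𝐋 ⊔ (𝐗 ⊔ 𝐘)) ∖ 𝐛) ∷ (𝐗 ⊔ 𝐘 ≗ 𝐛) ∷ []) (𝐚 ⊔ 𝐋 ≗ 𝐋) (C ∷ A ∪ B ∷ [])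
        (⊆⇒∪≡ (≡.subst (λ S → C ⊆ S ─ (A ∪ B)) N≡ C⊆N─ab) ∷ xy≡AB ∷ []))
      difference : r ! (Z ∪ Z ∪ C) + r ! C - r ! (Z ∪ C) - r ! (Z ∪ C) ≈ r ! C - r ! (Z ∪ C)
      difference = trans
        (+-congʳ (+-congʳ (+-congʳ (reflexive (≡.cong (r !_) (identity [] (𝐙 ⊔ 𝐙 ⊔ 𝐚 ≗ 𝐙 ⊔ 𝐚) (C ∷ []) []))))))
        (solve 2 (λ p q → p :+ q :- p :- p := q :- p) refl _ _)
      ZZC⇔ : Z ⊥ Z ∥ C [ r ] ⇔ r ! (Z ∪ C) ≈ r ! C
      ZZC⇔ = mk⇔ (λ eq → sym (x-y≈0⇒x≈y (trans (sym difference) eq)))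
                 (λ eq → trans difference (x≈y⇒x-y≈0 (sym eq)))

mainTheorem10 :
  (ℝ : RealNumbers) (u : ℕ) →
  let open RealNumbers ℝ in
  let open SetFunctions ℝ u in
  (N M : Subset u) (z x y : Fin u) →
  let L = M ─ ⁅ z ⁆ in
  z ∈ M → L ⊆ N → N ─ L ≡ ⁅ x ⁆ ∪ ⁅ y ⁆ → x ≢ y →
  (r : ℝ^𝒫 M) →
  let m = upperReplication N z r in
  -- (i)
  ( (𝒦 N m ⇔ (𝒦 M r × r ! M ≤ r ! L))
  × (𝒦 N m → ∀ a b C → ℰ N a b C →
      ( Nonempty ((⁅ x ⁆ ∪ ⁅ y ⁆) ∩ C) →
        (⁅ a ⁆ ⊥ ⁅ b ⁆ ∥ C [ m ] ⇔ (⁅ a ⁆ ∩ L) ⊥ (⁅ b ⁆ ∩ L) ∥ (⁅ z ⁆ ∪ (C ∩ L)) [ r ]) )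
      ×
      ( ⁅ a ⁆ ∪ ⁅ b ⁆ ∪ C ⊆ L →
        (⁅ a ⁆ ⊥ ⁅ b ⁆ ∥ C [ m ] ⇔ ⁅ a ⁆ ⊥ ⁅ b ⁆ ∥ C [ r ]) )
      ×
      ( ∣ (⁅ x ⁆ ∪ ⁅ y ⁆) ∩ (⁅ a ⁆ ∪ ⁅ b ⁆) ∣ ≡ 1 → Empty ((⁅ x ⁆ ∪ ⁅ y ⁆) ∩ C) →
        (⁅ a ⁆ ⊥ ⁅ b ⁆ ∥ C [ m ] ⇔ ⁅ z ⁆ ⊥ ((⁅ a ⁆ ∪ ⁅ b ⁆) ∩ L) ∥ C [ r ]) )
      ×
      ( ⁅ x ⁆ ∪ ⁅ y ⁆ ≡ ⁅ a ⁆ ∪ ⁅ b ⁆ →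
        (⁅ a ⁆ ⊥ ⁅ b ⁆ ∥ C [ m ] ⇔ r ! (⁅ z ⁆ ∪ C) ≈ r ! C) ) ) )
  ×
  -- (ii)
  ( (𝒦ᵤ M r → 𝒦ᵤ N m)
  × (𝒦ᵤ M r → (Extreme M r ⇔ Extreme N m)) )
  ×
  -- (iii)
  ( (Extreme M r → r ! L ≈ r ! M →
      Extreme N m × m ≋ upperReplication N z (upperStandardization r))
  × (Extreme N m →
      (Extreme M r × r ! L ≈ r ! M)
      ⊎ (r ! M < r ! L × ℒ M r × m ≋ (r ! L - r ! M) · subsetIndicator L)) )
mainTheorem10 ℝ u N M z x y z∈M L⊆N N─L≡xy x≢y r =
  ( mk⇔ (λ Tr∈𝒦 → T-𝒦⁻¹ Tr∈𝒦 , T-𝒦⇒rM≤rL Tr∈𝒦) (λ (r∈𝒦 , rM≤rL) → T-𝒦 r∈𝒦 rM≤rL)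
  , λ _ a b C abC∈ℰ → let open Independence r {a} {b} {C} abC∈ℰ in
      meeting-xy , inside-L , one-of-xy , both-xy ) ,
  ( T-𝒦ᵤ
  , λ r∈𝒦ᵤ → let rL≈rM = 𝒦ᵤ⇒L≈M {r} r∈𝒦ᵤ in mk⇔ (T-extreme rL≈rM) (T-extreme⁻¹ rL≈rM) ) ,
  ( (λ r-extreme rL≈rM → T-extreme rL≈rM r-extreme , T-upperStandardization r rL≈rM)
  , λ Tr-extreme → alternative Tr-extreme (r ! L ≟ r ! M) )
  where
  open RealNumbers ℝ
  open OrderedField ℝ
  open SetFunctions ℝ u
  open Faces ℝ u
  open Replication ℝ u N M z x y z∈M L⊆N N─L≡xy x≢y

  T-extreme : r ! L ≈ r ! M → Extreme M r → Extreme N (T r)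
  T-extreme rL≈rM r-extreme = extremal⇒extreme (T-extremal rL≈rM (extreme⇒extremal r-extreme))

  T-extreme⁻¹ : r ! L ≈ r ! M → Extreme N (T r) → Extreme M r
  T-extreme⁻¹ rL≈rM Tr-extreme = extremal⇒extreme (T-extremal⁻¹ rL≈rM (extreme⇒extremal Tr-extreme))

  alternative : Extreme N (T r) → Dec (r ! L ≈ r ! M) →
    (Extreme M r × r ! L ≈ r ! M) ⊎
    (r ! M < r ! L × ℒ M r × T r ≋ (r ! L - r ! M) · subsetIndicator L)
  alternative Tr-extreme (yes rL≈rM) = inj₁ (T-extreme⁻¹ rL≈rM Tr-extreme , rL≈rM)
  alternative Tr-extreme (no rL≉rM)  = inj₂
    ( (T-𝒦⇒rM≤rL (proj₁ Tr-extreme) , λ rM≈rL → rL≉rM (sym rM≈rL))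
    , T-extremal-steep (extreme⇒extremal Tr-extreme) rL≉rM )
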